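{- For all integers $n\ge 1$ and $a,b\ge 0$ there exists a bijection $\zeta:\widetilde{\mathcal D}_n^{(a,b)}\to\widehat{\mathcal D}_n^{(b,a)}$ such that for every $D\in\widetilde{\mathcal D}_n^{(a,b)}$ we have $\mathsf{area}(D)=\mathsf{bounce}(\zeta(D))$ and $\mathsf{dinv}(D)=\mathsf{area}(\zeta(D))$.
   Context: A Dyck path of size $n$ is a lattice path from $(0,0)$ to $(n,n)$ with unit north and east steps staying weakly above $y=x$. Its $i$-th north step lies in row $i$; the area word is $w_1(D)\cdots w_n(D)$, $w_i(D)$ being the number of whole unit squares in row $i$ between the path and $y=x$. A peak is a north step followed by an east step; a rise is a north step followed by a north step. $\mathcal D_n^{(a,b)}$ is the set of Dyck paths of size $n$ with a choice of $a$ decorated peaks and $b$ decorated rises. $\mathsf{Peak}(D)$ (resp. $\mathsf{Rise}(D)$) is the set of $i$ such that the $i$-th north step is a decorated peak (resp. rise). $\mathsf{area}(D)=\sum_i w_i(D)-\sum_{j\in\mathsf{Rise}(D)}w_{j+1}(D)$. $\mathsf{dinv}(D)$ is the number of pairs $1\le i<j\le n$ with either $w_i=w_j$ and $i\notin\mathsf{Peak}(D)$, or $w_i=w_j+1$ and $j\notin\mathsf{Peak}(D)$. The first bounce path starts at $(0,0)$, goes north until it reaches the starting point of an east step of $D$, then east until it reaches $y=x$, then north, and so on until $(n,n)$; its north steps are labelled $0$ before its first north-to-east turn, $1$ between the first and second turns, etc.; $b_i(D)$ is the label in row $i$ and $\mathsf{bounce}(D)=\sum_{i\notin\mathsf{Peak}(D)}b_i(D)$.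 $\widetilde{\mathcal D}_n^{(a,b)}\subseteq\mathcal D_n^{(a,b)}$ consists of the elements whose rightmost highest peak (the peak in row $i$ with $w_i$ maximal and $i$ largest among such) is not decorated; $\widehat{\mathcal D}_n^{(a,b)}\subseteq\mathcal D_n^{(a,b)}$ consists of the elements whose first peak (the peak in the leftmost column) is not decorated. -}

module Defs where

open import Data.Bool using (Bool; true; false; not; _∧_; _∨_; if_then_else_; T)
open import Data.Nat using (ℕ; zero; suc; _+_; _∸_; _≡ᵇ_; _<ᵇ_; _⊔_)
open import Data.List using (List; []; _∷_; length; map; foldr; upTo; replicate; _++_; zipWith)
open import Data.Nat.ListAction using (sum)
open import Data.Bool.ListAction using (and)
open import Data.Product using (Σ; _×_; _,_; proj₁; proj₂)

-- Dyck paths as sequences of unit steps (north N, east E).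
-- Rows / north steps are indexed 0-based internally: row r here is
-- row r+1 of the paper.

data Step : Set where
  N E : Step

dyckAux : ℕ → ℕ → List Step → ℕ → Bool
dyckAux k e []      n = (k ≡ᵇ n) ∧ (e ≡ᵇ n)
dyckAux k e (N ∷ s) n = dyckAux (suc k) e s n
dyckAux k e (E ∷ s) n = (e <ᵇ k) ∧ dyckAux k (suc e) s n

isDyck : ℕ → List Step → Bool
isDyck n p = dyckAux 0 0 p n

-- Area word: the north step in row r+1 starts at (x, r) with x the number
-- of east steps before it; the number of whole squares between the path
-- and y = x in that row is r - x.
areaWordAux : ℕ → ℕ → List Step → List ℕ
areaWordAux k e []      = []
areaWordAux k e (N ∷ s) = (k ∸ e) ∷ areaWordAux (suc k) e s
areaWordAux k e (E ∷ s) = areaWordAux k (suc e) s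

areaWord : List Step → List ℕ
areaWord = areaWordAux 0 0

peakFlags : List Step → List Bool
peakFlags []            = []
peakFlags (E ∷ s)       = peakFlags s
peakFlags (N ∷ [])      = false ∷ []
peakFlags (N ∷ N ∷ s)   = false ∷ peakFlags (N ∷ s)
peakFlags (N ∷ E ∷ s)   = true ∷ peakFlags (E ∷ s)

riseFlags : List Step → List Bool
riseFlags []            = []
riseFlags (E ∷ s)       = riseFlags s
riseFlags (N ∷ [])      = false ∷ []
riseFlags (N ∷ N ∷ s)   = true ∷ riseFlags (N ∷ s)
riseFlags (N ∷ E ∷ s)   = false ∷ riseFlags (E ∷ s)

atℕ : List ℕ → ℕ → ℕ
atℕ []       _       = 0
atℕ (x ∷ xs) zero    = x
atℕ (x ∷ xs) (suc i) = atℕ xs i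

atB : List Bool → ℕ → Bool
atB []       _       = false
atB (x ∷ xs) zero    = x
atB (x ∷ xs) (suc i) = atB xs i

countTrue : List Bool → ℕ
countTrue []           = 0
countTrue (true ∷ bs)  = suc (countTrue bs)
countTrue (false ∷ bs) = countTrue bs

subFlags : List Bool → List Bool → Bool
subFlags d allowed = and (zipWith (λ x y → not x ∨ y) d allowed)

-- Decorated Dyck paths: a path, a set of decorated peaks and a set of
-- decorated rises (as characteristic lists indexed by rows).

record Raw : Set where
  constructor raw
  field
    path  : List Step
    dPeak : List Bool   -- dPeak[r] = true iff row r+1 ∈ Peak(D)
    dRise : List Bool   -- dRise[r] = true iff row r+1 ∈ Rise(D)
open Raw public

validDecorated : ℕ → ℕ → ℕ → Raw → Bool
validDecorated n a b (raw p dp dr) =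
  isDyck n p
  ∧ (length dp ≡ᵇ n) ∧ (length dr ≡ᵇ n)
  ∧ subFlags dp (peakFlags p) ∧ subFlags dr (riseFlags p)
  ∧ (countTrue dp ≡ᵇ a) ∧ (countTrue dr ≡ᵇ b)

𝒟 : ℕ → ℕ → ℕ → Set
𝒟 n a b = Σ Raw (λ D → T (validDecorated n a b D))

rows : List Step → List ℕ
rows p = upTo (length (areaWord p))

-- area(D) = Σ_i w_i − Σ_{j ∈ Rise} w_{j+1}   (always ≥ 0, so ∸ is exact)
areaR : Raw → ℕ
areaR (raw p dp dr) =
  sum w ∸ sum (map (λ j → if atB dr j then atℕ w (suc j) else 0) (rows p))
  where w = areaWord p

dinvR : Raw → ℕ
dinvR (raw p dp dr) =
  sum (map (λ i → sum (map (λ j → pairCount i j) (rows p))) (rows p))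
  where
  w = areaWord p
  pairCount : ℕ → ℕ → ℕ
  pairCount i j =
    if (i <ᵇ j) ∧ ( ((atℕ w i ≡ᵇ atℕ w j) ∧ not (atB dp i))
                  ∨ ((atℕ w i ≡ᵇ suc (atℕ w j)) ∧ not (atB dp j)) )
    then 1 else 0

-- For each east step, the number of north steps before it.  The east step
-- starting in column x is the (x+1)-th one, and starts at height
-- northBeforeE p [x].
northBeforeEAux : ℕ → List Step → List ℕ
northBeforeEAux k []      = []
northBeforeEAux k (N ∷ s) = northBeforeEAux (suc k) s
northBeforeEAux k (E ∷ s) = k ∷ northBeforeEAux k s

northBeforeE : List Step → List ℕ
northBeforeE = northBeforeEAux 0

-- Bounce path: from (b,b) on the diagonal (b = 0 initially) go north to
-- height b' = height of the start of the east step of D in column b, then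
-- east back to the diagonal at (b',b').  Rows b+1 .. b' (1-based) get
-- label k.  fuel bounds the number of bounces.
bounceLabelsAux : ℕ → List ℕ → ℕ → ℕ → ℕ → List ℕ
bounceLabelsAux zero       nb n k b = []
bounceLabelsAux (suc fuel) nb n k b =
  if b <ᵇ n
  then replicate (atℕ nb b ∸ b) k ++ bounceLabelsAux fuel nb n (suc k) (atℕ nb b)
  else []

-- bounceLabels p [r] = b_{r+1}(D)
bounceLabels : List Step → List ℕ
bounceLabels p = bounceLabelsAux n (northBeforeE p) n 0 0
  where n = length (areaWord p)

bounceR : Raw → ℕ
bounceR (raw p dp dr) =
  sum (map (λ r → if atB dp r then 0 else atℕ (bounceLabels p) r) (rows p))

area dinv bounce : ∀ {n a b} → 𝒟 n a b → ℕ
area   D = areaR (proj₁ D)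
dinv   D = dinvR (proj₁ D)
bounce D = bounceR (proj₁ D)

maxPeakW : List Step → ℕ
maxPeakW p = foldr _⊔_ 0
  (map (λ r → if atB (peakFlags p) r then atℕ (areaWord p) r else 0) (rows p))

rightmostHighestPeak : List Step → ℕ
rightmostHighestPeak p = foldr pick 0 (rows p)
  where
  pick : ℕ → ℕ → ℕ
  pick r acc = if atB (peakFlags p) r ∧ (atℕ (areaWord p) r ≡ᵇ maxPeakW p)
               then (if r <ᵇ acc then acc else r) else acc

firstPeakAux : ℕ → List Bool → ℕ
firstPeakAux r []           = r
firstPeakAux r (true ∷ bs)  = r
firstPeakAux r (false ∷ bs) = firstPeakAux (suc r) bs

firstPeak : List Step → ℕ
firstPeak p = firstPeakAux 0 (peakFlags p)

𝒟̃ : ℕ → ℕ → ℕ → Set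
𝒟̃ n a b = Σ (𝒟 n a b) (λ D →
  T (not (atB (dPeak (proj₁ D)) (rightmostHighestPeak (path (proj₁ D))))))

𝒟̂ : ℕ → ℕ → ℕ → Set
𝒟̂ n a b = Σ (𝒟 n a b) (λ D →
  T (not (atB (dPeak (proj₁ D)) (firstPeak (path (proj₁ D))))))

{-# OPTIONS --safe #-}
module Submission where

-- A decorated Dyck path D is the depth-first code of a plane forest whose
-- flagged leaves are the decorated peaks and whose flagged inner nodes are
-- the decorated rises; w_i is the depth of the i-th node.  The image of D is
-- the breadth-first code of the same forest: one north step per root, and
-- then, for each node in breadth-first order, an east step followed by one
-- north step per child.  Its bounce labels are the depths of the nodes, and
-- its height after the east step of a node p is the number of nodes still in
-- the queue, which is the number of dinv pairs discounted when p is decorated: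
-- the later nodes of the same depth and the earlier nodes one level deeper.
-- Transporting the flag of p to the next east step, a flagged inner node
-- decorates the peak at its last child, and a flagged leaf decorates a pair
-- of consecutive east steps, which parenthesis matching turns into a rise of
-- the same height.  Only the flag of the last node in breadth-first order,
-- the rightmost highest peak of D, has no place to go, and only the first
-- peak of the image receives no flag.

open import Defs
open import Data.Bool using (Bool; true; false; not; _∧_; _∨_; if_then_else_; T)
open import Data.Bool.ListAction using (or)
open import Data.Bool.Properties using (T-∧; T-≡; T-not-≡; T-irrelevant; ∨-zeroʳ)
open import Data.Empty using (⊥; ⊥-elim)
open import Data.List using (List; []; _∷_; length; map; foldr; upTo; applyUpTo; replicate; _++_)
open import Data.List.Properties using (map-upTo; ++-assoc; ++-identityʳ; length-++; ∷-injective)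
open import Data.Nat
open import Data.Nat.ListAction using (sum)
open import Data.Nat.Properties
open import Data.Nat.Tactic.RingSolver using (solve-∀)
open import Data.Product using (Σ; ∃; _×_; _,_; proj₁; proj₂)
open import Data.Unit using (⊤; tt)
open import Data.Vec using (Vec; []; _∷_)
open import Function using (_∘_; const; id)
open import Function.Bundles using (_⤖_; Bijection; mk⤖; Equivalence)
open import Relation.Binary.PropositionalEquality
  using (_≡_; refl; sym; trans; cong; cong₂; subst; module ≡-Reasoning)

-- Words with flagged north steps

-- A decorated Dyck path as a word in which the flag of a north step says
-- whether it is decorated, be it as a peak or as a rise.
data NorthFlagged : Set where
  ↑_ : Bool → NorthFlagged
  ↓  : NorthFlagged

steps : List NorthFlagged → List Step
steps []        = []
steps (↑ _ ∷ s) = N ∷ steps s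
steps (↓ ∷ s)   = E ∷ steps s

peaks : List NorthFlagged → List Bool
peaks []              = []
peaks (↓ ∷ s)         = peaks s
peaks (↑ _ ∷ [])      = false ∷ []
peaks (↑ _ ∷ ↑ c ∷ s) = false ∷ peaks (↑ c ∷ s)
peaks (↑ b ∷ ↓ ∷ s)   = b ∷ peaks s

rises : List NorthFlagged → List Bool
rises []              = []
rises (↓ ∷ s)         = rises s
rises (↑ _ ∷ [])      = false ∷ []
rises (↑ b ∷ ↑ c ∷ s) = b ∷ rises (↑ c ∷ s)
rises (↑ _ ∷ ↓ ∷ s)   = false ∷ rises s

toRaw : List NorthFlagged → Raw
toRaw s = raw (steps s) (peaks s) (rises s)

-- `h` is the excess of north over east steps made so far, one counter in place of the two of
-- `dyckAux`; the size of the path is kept apart, as `norths`.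
DyckFrom : ℕ → List Step → Set
DyckFrom h       (N ∷ p) = DyckFrom (suc h) p
DyckFrom zero    []      = ⊤
DyckFrom (suc _) []      = ⊥
DyckFrom zero    (E ∷ p) = ⊥
DyckFrom (suc h) (E ∷ p) = DyckFrom h p

norths : List Step → ℕ
norths []      = 0
norths (N ∷ p) = suc (norths p)
norths (E ∷ p) = norths p

∧⇒× : ∀ {x y} → T (x ∧ y) → T x × T y
∧⇒× = Equivalence.to T-∧

×⇒∧ : ∀ {x y} → T x → T y → T (x ∧ y)
×⇒∧ t u = Equivalence.from T-∧ (t , u)

dyckAux⇒DyckFrom : ∀ h e p n → T (dyckAux (h + e) e p n) → DyckFrom h p × h + e + norths p ≡ n
dyckAux⇒DyckFrom h e [] n t with ∧⇒× {h + e ≡ᵇ n} t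
... | k≡n , e≡n with ≡ᵇ⇒≡ (h + e) n k≡n | ≡ᵇ⇒≡ e n e≡n
dyckAux⇒DyckFrom zero e [] n t | _ | _ | eq = tt , trans (+-identityʳ e) eq
dyckAux⇒DyckFrom (suc h) e [] n t | _ | eq′ | eq = ⊥-elim (m≢1+n+m e (trans eq (sym eq′)))
dyckAux⇒DyckFrom h e (N ∷ p) n t with dyckAux⇒DyckFrom (suc h) e p n t
... | d , eq = d , trans (+-suc (h + e) (norths p)) eq
dyckAux⇒DyckFrom zero e (E ∷ p) n t = ⊥-elim (<-irrefl refl (<ᵇ⇒< e e (proj₁ (∧⇒× {e <ᵇ e} t))))
dyckAux⇒DyckFrom (suc h) e (E ∷ p) n t
  with dyckAux⇒DyckFrom h (suc e) p n
         (subst (λ k → T (dyckAux k (suc e) p n)) (sym (+-suc h e)) (proj₂ (∧⇒× {e <ᵇ suc (h + e)} t)))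
... | d , eq = d , trans (cong (_+ norths p) (sym (+-suc h e))) eq

DyckFrom⇒dyckAux : ∀ h e p n → DyckFrom h p → h + e + norths p ≡ n → T (dyckAux (h + e) e p n)
DyckFrom⇒dyckAux zero e [] n d eq =
  ×⇒∧ {e ≡ᵇ n} (≡⇒≡ᵇ e n e≡n) (≡⇒≡ᵇ e n e≡n) where e≡n = trans (sym (+-identityʳ e)) eq
DyckFrom⇒dyckAux h e (N ∷ p) n d eq =
  DyckFrom⇒dyckAux (suc h) e p n d (trans (sym (+-suc (h + e) (norths p))) eq)
DyckFrom⇒dyckAux (suc h) e (E ∷ p) n d eq =
  ×⇒∧ {e <ᵇ suc (h + e)} (<⇒<ᵇ (s≤s (m≤n+m e h)))
    (subst (λ k → T (dyckAux k (suc e) p n)) (+-suc h e)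
      (DyckFrom⇒dyckAux h (suc e) p n d (trans (cong (_+ norths p) (+-suc h e)) eq)))

record WordOf (n a b : ℕ) (s : List NorthFlagged) : Set where
  constructor wordOf
  field
    dyck   : DyckFrom 0 (steps s)
    size   : norths (steps s) ≡ n
    #peaks : countTrue (peaks s) ≡ a
    #rises : countTrue (rises s) ≡ b

length-peaks : ∀ s → length (peaks s) ≡ norths (steps s)
length-peaks []              = refl
length-peaks (↓ ∷ s)         = length-peaks s
length-peaks (↑ _ ∷ [])      = refl
length-peaks (↑ _ ∷ ↑ c ∷ s) = cong suc (length-peaks (↑ c ∷ s))
length-peaks (↑ _ ∷ ↓ ∷ s)   = cong suc (length-peaks s)

length-rises : ∀ s → length (rises s) ≡ norths (steps s)
length-rises []              = refl
length-rises (↓ ∷ s)         = length-rises s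
length-rises (↑ _ ∷ [])      = refl
length-rises (↑ _ ∷ ↑ c ∷ s) = cong suc (length-rises (↑ c ∷ s))
length-rises (↑ _ ∷ ↓ ∷ s)   = cong suc (length-rises s)

peaks⊆peakFlags : ∀ s → T (subFlags (peaks s) (peakFlags (steps s)))
peaks⊆peakFlags []                  = tt
peaks⊆peakFlags (↓ ∷ s)             = peaks⊆peakFlags s
peaks⊆peakFlags (↑ _ ∷ [])          = tt
peaks⊆peakFlags (↑ _ ∷ ↑ c ∷ s)     = peaks⊆peakFlags (↑ c ∷ s)
peaks⊆peakFlags (↑ false ∷ ↓ ∷ s)   = peaks⊆peakFlags s
peaks⊆peakFlags (↑ true ∷ ↓ ∷ s)    = peaks⊆peakFlags s

rises⊆riseFlags : ∀ s → T (subFlags (rises s) (riseFlags (steps s)))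
rises⊆riseFlags []                    = tt
rises⊆riseFlags (↓ ∷ s)               = rises⊆riseFlags s
rises⊆riseFlags (↑ _ ∷ [])            = tt
rises⊆riseFlags (↑ false ∷ ↑ c ∷ s)   = rises⊆riseFlags (↑ c ∷ s)
rises⊆riseFlags (↑ true ∷ ↑ c ∷ s)    = rises⊆riseFlags (↑ c ∷ s)
rises⊆riseFlags (↑ _ ∷ ↓ ∷ s)         = rises⊆riseFlags s

wordOf⇒valid : ∀ {n a b s} → WordOf n a b s → T (validDecorated n a b (toRaw s))
wordOf⇒valid {n} {a} {b} {s} (wordOf dyck size #peaks #rises) =
  ×⇒∧ {isDyck n (steps s)} (DyckFrom⇒dyckAux 0 0 (steps s) n dyck size)
  (×⇒∧ {length (peaks s) ≡ᵇ n} (≡⇒≡ᵇ _ n (trans (length-peaks s) size))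
  (×⇒∧ {length (rises s) ≡ᵇ n} (≡⇒≡ᵇ _ n (trans (length-rises s) size))
  (×⇒∧ {subFlags (peaks s) (peakFlags (steps s))} (peaks⊆peakFlags s)
  (×⇒∧ {subFlags (rises s) (riseFlags (steps s))} (rises⊆riseFlags s)
  (×⇒∧ {countTrue (peaks s) ≡ᵇ a} (≡⇒≡ᵇ _ a #peaks) (≡⇒≡ᵇ _ b #rises))))))

record Validity (n a b : ℕ) (D : Raw) : Set where
  field
    dyck    : DyckFrom 0 (path D)
    size    : norths (path D) ≡ n
    length₁ : length (dPeak D) ≡ n
    length₂ : length (dRise D) ≡ n
    ⊆peaks  : T (subFlags (dPeak D) (peakFlags (path D)))
    ⊆rises  : T (subFlags (dRise D) (riseFlags (path D)))
    #peaks  : countTrue (dPeak D) ≡ a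
    #rises  : countTrue (dRise D) ≡ b

validity : ∀ {n a b} D → T (validDecorated n a b D) → Validity n a b D
validity {n} {a} {b} (raw p dp dr) t =
  let t₁ , u₁ = ∧⇒× {isDyck n p} t
      t₂ , u₂ = ∧⇒× {length dp ≡ᵇ n} u₁
      t₃ , u₃ = ∧⇒× {length dr ≡ᵇ n} u₂
      t₄ , u₄ = ∧⇒× {subFlags dp (peakFlags p)} u₃
      t₅ , u₅ = ∧⇒× {subFlags dr (riseFlags p)} u₄
      t₆ , t₇ = ∧⇒× {countTrue dp ≡ᵇ a} u₅
      d , eq  = dyckAux⇒DyckFrom 0 0 p n t₁
  in record { dyck = d ; size = eq
            ; length₁ = ≡ᵇ⇒≡ _ n t₂ ; length₂ = ≡ᵇ⇒≡ _ n t₃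
            ; ⊆peaks = t₄ ; ⊆rises = t₅
            ; #peaks = ≡ᵇ⇒≡ _ a t₆ ; #rises = ≡ᵇ⇒≡ _ b t₇ }

valid⇒wordOf : ∀ {n a b s} → T (validDecorated n a b (toRaw s)) → WordOf n a b s
valid⇒wordOf {s = s} t = let open Validity (validity (toRaw s) t) in wordOf dyck size #peaks #rises

-- In every row one of the two decorations is forced to be `false`: the peak if a north step
-- follows, the rise if an east step follows. The other one becomes the flag of the north step.
flagWord : ∀ h p dp dr → DyckFrom h p → length dp ≡ norths p → length dr ≡ norths p →
           T (subFlags dp (peakFlags p)) → T (subFlags dr (riseFlags p)) →
           ∃ λ s → steps s ≡ p × peaks s ≡ dp × rises s ≡ dr
flagWord h [] [] [] d l₁ l₂ t u = [] , refl , refl , refl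
flagWord h (N ∷ []) dp dr () l₁ l₂ t u
flagWord h (N ∷ N ∷ p) (true ∷ dp) dr d l₁ l₂ () u
flagWord h (N ∷ N ∷ p) (false ∷ dp) (y ∷ dr) d l₁ l₂ t u
  with flagWord (suc h) (N ∷ p) dp dr d (suc-injective l₁) (suc-injective l₂) t (rest y u)
  where
  rest : ∀ y → T (subFlags (y ∷ dr) (riseFlags (N ∷ N ∷ p))) → T (subFlags dr (riseFlags (N ∷ p)))
  rest true  u = u
  rest false u = u
... | ↑ c ∷ s , refl , refl , refl = ↑ y ∷ ↑ c ∷ s , refl , refl , refl
flagWord h (N ∷ E ∷ p) dp (true ∷ dr) d l₁ l₂ t ()
flagWord h (N ∷ E ∷ p) (x ∷ dp) (false ∷ dr) d l₁ l₂ t u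
  with flagWord h p dp dr d (suc-injective l₁) (suc-injective l₂) (rest x t) u
  where
  rest : ∀ x → T (subFlags (x ∷ dp) (true ∷ peakFlags p)) → T (subFlags dp (peakFlags p))
  rest true  t = t
  rest false t = t
... | s , refl , refl , refl = ↑ x ∷ ↓ ∷ s , refl , refl , refl
flagWord zero (E ∷ p) dp dr () l₁ l₂ t u
flagWord (suc h) (E ∷ p) dp dr d l₁ l₂ t u with flagWord h p dp dr d l₁ l₂ t u
... | s , refl , refl , refl = ↓ ∷ s , refl , refl , refl

valid⇒flagged : ∀ {n a b} D → T (validDecorated n a b D) → ∃ λ s → toRaw s ≡ D × WordOf n a b s
valid⇒flagged D t
  with flagWord 0 (path D) (dPeak D) (dRise D) dyck (trans length₁ (sym size)) (trans length₂ (sym size)) ⊆peaks ⊆rises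
  where open Validity (validity D t)
... | s , refl , refl , refl = s , refl , valid⇒wordOf t

-- A final north step would hide its flag from both `peaks` and `rises`; the Dyck condition excludes
-- it. Every other flag is visible in exactly one of the two lists.
toRaw-injective : ∀ h s s′ → DyckFrom h (steps s) → steps s ≡ steps s′ → peaks s ≡ peaks s′ →
                  rises s ≡ rises s′ → s ≡ s′
toRaw-injective h [] [] d eq eq₁ eq₂ = refl
toRaw-injective h [] (↑ _ ∷ s′) d ()
toRaw-injective h [] (↓ ∷ s′) d ()
toRaw-injective h (↑ b ∷ []) _ () eq eq₁ eq₂
toRaw-injective h (↑ b ∷ ↑ c ∷ s) (↑ b′ ∷ ↑ c′ ∷ s′) d eq eq₁ eq₂ =
  cong₂ (λ x → ↑ x ∷_) (proj₁ (∷-injective eq₂))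
    (toRaw-injective (suc h) (↑ c ∷ s) (↑ c′ ∷ s′) d
      (proj₂ (∷-injective eq)) (proj₂ (∷-injective eq₁)) (proj₂ (∷-injective eq₂)))
toRaw-injective h (↑ b ∷ ↓ ∷ s) (↑ b′ ∷ ↓ ∷ s′) d eq eq₁ eq₂ =
  cong₂ (λ x t → ↑ x ∷ ↓ ∷ t) (proj₁ (∷-injective eq₁))
    (toRaw-injective h s s′ d
      (proj₂ (∷-injective (proj₂ (∷-injective eq)))) (proj₂ (∷-injective eq₁)) (proj₂ (∷-injective eq₂)))
toRaw-injective zero    (↓ ∷ s) _ () eq eq₁ eq₂
toRaw-injective (suc h) (↓ ∷ s) (↓ ∷ s′) d eq eq₁ eq₂ =
  cong (↓ ∷_) (toRaw-injective h s s′ d (proj₂ (∷-injective eq)) eq₁ eq₂)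

-- Plane forests and their codes

data Tree : Set where
  node : Bool → List Tree → Tree

Forest : Set
Forest = List Tree

dfs : Forest → List NorthFlagged → List NorthFlagged
dfs []              s = s
dfs (node b ts ∷ f) s = ↑ b ∷ dfs ts (↓ ∷ dfs f s)

-- What is left of a depth-first code inside `h` open nodes: for each of them, innermost first, the
-- east step that closes it and the siblings to its right.
closing : ∀ {h} → Vec Forest h → List NorthFlagged
closing []       = []
closing (f ∷ fs) = ↓ ∷ dfs f (closing fs)

parse : ∀ h s → DyckFrom h (steps s) → ∃ λ f → Σ (Vec Forest h) λ fs → s ≡ dfs f (closing fs)
parse zero [] d = [] , [] , refl
parse h (↑ b ∷ s) d with parse (suc h) s d
... | ts , f ∷ fs , refl = node b ts ∷ f , fs , refl
parse zero (↓ ∷ s) ()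
parse (suc h) (↓ ∷ s) d with parse h s d
... | f , fs , refl = [] , f ∷ fs , refl

-- The common word `s` is an argument of its own so that the recursion can descend on it, while
-- trees move between the current forest and the vector of pending ones.
dfs-closing-injective : ∀ {h} s f g (fs gs : Vec Forest h) → s ≡ dfs f (closing fs) → s ≡ dfs g (closing gs) →
                        f ≡ g × fs ≡ gs
dfs-closing-injective [] [] [] [] [] eq eq′ = refl , refl
dfs-closing-injective (↓ ∷ s) [] [] (f ∷ fs) (g ∷ gs) eq eq′
  with dfs-closing-injective s f g fs gs (proj₂ (∷-injective eq)) (proj₂ (∷-injective eq′))
... | refl , refl = refl , refl
dfs-closing-injective s [] (node _ _ ∷ _) [] _ refl ()
dfs-closing-injective s [] (node _ _ ∷ _) (_ ∷ _) _ refl ()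
dfs-closing-injective s (node _ _ ∷ _) [] _ [] refl ()
dfs-closing-injective s (node _ _ ∷ _) [] _ (_ ∷ _) refl ()
dfs-closing-injective (↑ c ∷ s) (node b ts ∷ f) (node b′ us ∷ g) fs gs eq eq′
  with dfs-closing-injective s ts us (f ∷ fs) (g ∷ gs) (proj₂ (∷-injective eq)) (proj₂ (∷-injective eq′))
     | trans (sym (proj₁ (∷-injective eq))) (proj₁ (∷-injective eq′))
... | refl , refl | refl = refl , refl

dfs-injective : ∀ f g → dfs f [] ≡ dfs g [] → f ≡ g
dfs-injective f g eq = proj₁ (dfs-closing-injective (dfs f []) f g [] [] refl eq)

dfs-dyck : ∀ h f s → DyckFrom h (steps s) → DyckFrom h (steps (dfs f s))
dfs-dyck h [] s d = d
dfs-dyck h (node b ts ∷ f) s d = dfs-dyck (suc h) ts (↓ ∷ dfs f s) (dfs-dyck h f s d)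

-- The summand gets the depth of a node, its flag and its number of children; `d` is the depth of
-- the roots. The statistics of both codes are compared in this form or as `sumC`.
sumF : (ℕ → Bool → ℕ → ℕ) → ℕ → Forest → ℕ
sumF φ d []              = 0
sumF φ d (node b ts ∷ f) = φ d b (length ts) + (sumF φ (suc d) ts + sumF φ d f)

children : Forest → Forest
children []              = []
children (node _ ts ∷ f) = ts ++ children f

Code : Set
Code = List (Bool × ℕ)

roots : Forest → Code
roots []              = []
roots (node b ts ∷ f) = (b , length ts) ∷ roots f

-- The forest is the content of the queue of a breadth-first traversal.
data BFS : Forest → Code → Set where
  []   : BFS [] []
  node : ∀ {f cs} b ts → BFS (f ++ ts) cs → BFS (node b ts ∷ f) ((b , length ts) ∷ cs)

sumF-++ : ∀ φ d f g → sumF φ d (f ++ g) ≡ sumF φ d f + sumF φ d g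
sumF-++ φ d [] g = refl
sumF-++ φ d (node b ts ∷ f) g rewrite sumF-++ φ d f g =
  solve-assoc (φ d b (length ts)) (sumF φ (suc d) ts) (sumF φ d f) (sumF φ d g)
  where
  solve-assoc : ∀ w x y z → w + (x + (y + z)) ≡ w + (x + y) + z
  solve-assoc = solve-∀

sumF-cong : ∀ {φ ψ} → (∀ d b k → φ d b k ≡ ψ d b k) → ∀ d f → sumF φ d f ≡ sumF ψ d f
sumF-cong eq d [] = refl
sumF-cong eq d (node b ts ∷ f) = cong₂ _+_ (eq d b (length ts)) (cong₂ _+_ (sumF-cong eq (suc d) ts) (sumF-cong eq d f))

sumF-+ : ∀ φ ψ d f → sumF (λ d b k → φ d b k + ψ d b k) d f ≡ sumF φ d f + sumF ψ d f
sumF-+ φ ψ d [] = refl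
sumF-+ φ ψ d (node b ts ∷ f) rewrite sumF-+ φ ψ (suc d) ts | sumF-+ φ ψ d f =
  solve-assoc (φ d b (length ts)) (ψ d b (length ts)) (sumF φ (suc d) ts) (sumF ψ (suc d) ts) (sumF φ d f) (sumF ψ d f)
  where
  solve-assoc : ∀ u v w x y z → u + v + (w + x + (y + z)) ≡ u + (w + y) + (v + (x + z))
  solve-assoc = solve-∀

-- Each node is charged to its parent: a node of depth `d` has `k` children of depth `suc d`. The
-- roots have no parent here and give the first summand.
sumF-depth : ∀ d f → sumF (λ d _ _ → d) d f ≡ d * length f + sumF (λ d _ k → suc d * k) d f
sumF-depth d [] rewrite *-zeroʳ d = refl
sumF-depth d (node b ts ∷ f) rewrite sumF-depth (suc d) ts | sumF-depth d f =
  solve-assoc d (length ts) (length f) (sumF (λ d _ k → suc d * k) (suc d) ts) (sumF (λ d _ k → suc d * k) d f)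
  where
  solve-assoc : ∀ d t l x y → d + (suc d * t + x + (d * l + y)) ≡ d * suc l + (suc d * t + (x + y))
  solve-assoc = solve-∀

sumF-size : ∀ d f → sumF (λ _ _ _ → 1) d f ≡ length f + sumF (λ _ _ k → k) d f
sumF-size d [] = refl
sumF-size d (node b ts ∷ f) rewrite sumF-size (suc d) ts | sumF-size d f =
  solve-assoc (length ts) (length f) (sumF (λ _ _ k → k) (suc d) ts) (sumF (λ _ _ k → k) d f)
  where
  solve-assoc : ∀ t l x y → suc (t + x + (l + y)) ≡ suc l + (t + (x + y))
  solve-assoc = solve-∀

sumRoots : (Bool → ℕ → ℕ) → Forest → ℕ
sumRoots φ []              = 0
sumRoots φ (node b ts ∷ f) = φ b (length ts) + sumRoots φ f

sumF-level : ∀ φ d f → sumF φ d f ≡ sumRoots (φ d) f + sumF φ (suc d) (children f)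
sumF-level φ d [] = refl
sumF-level φ d (node b ts ∷ f)
  rewrite sumF-++ φ (suc d) ts (children f) | sumF-level φ d f =
  solve-assoc (φ d b (length ts)) (sumF φ (suc d) ts) (sumRoots (φ d) f) (sumF φ (suc d) (children f))
  where
  solve-assoc : ∀ w x y z → w + (x + (y + z)) ≡ w + y + (x + z)
  solve-assoc = solve-∀

-- m is the length of the queue; φ gets its length after the removal of the
-- current node, before the children of that node join it.
sumC : (ℕ → Bool → ℕ → ℕ) → ℕ → Code → ℕ
sumC φ m []             = 0
sumC φ m ((b , k) ∷ cs) = φ (pred m) b k + sumC φ (pred m + k) cs

sumC-+ : ∀ φ ψ m cs → sumC (λ q b k → φ q b k + ψ q b k) m cs ≡ sumC φ m cs + sumC ψ m cs
sumC-+ φ ψ m [] = refl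
sumC-+ φ ψ m ((b , k) ∷ cs) rewrite sumC-+ φ ψ (pred m + k) cs =
  solve-assoc (φ (pred m) b k) (ψ (pred m) b k) (sumC φ (pred m + k) cs) (sumC ψ (pred m + k) cs)
  where
  solve-assoc : ∀ u v x y → u + v + (x + y) ≡ u + x + (v + y)
  solve-assoc = solve-∀

sumC-cong : ∀ {φ ψ} → (∀ d b k → φ d b k ≡ ψ d b k) → ∀ m cs → sumC φ m cs ≡ sumC ψ m cs
sumC-cong eq m [] = refl
sumC-cong eq m ((b , k) ∷ cs) = cong₂ _+_ (eq (pred m) b k) (sumC-cong eq (pred m + k) cs)

-- Both sums run over the same nodes in different orders, and the summand sees only the flag and the
-- number of children.
BFS⇒sumF≡sumC : ∀ φ {f cs} m d → BFS f cs → sumF (λ _ → φ) d f ≡ sumC (λ _ → φ) m cs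
BFS⇒sumF≡sumC φ m d [] = refl
BFS⇒sumF≡sumC φ m d (node {f} {cs} b ts c) = cong (φ b (length ts) +_) (begin
  sumF (λ _ → φ) (suc d) ts + sumF (λ _ → φ) d f  ≡⟨ cong (_+ sumF (λ _ → φ) d f) (shift ts) ⟩
  sumF (λ _ → φ) d ts + sumF (λ _ → φ) d f        ≡⟨ +-comm (sumF (λ _ → φ) d ts) _ ⟩
  sumF (λ _ → φ) d f + sumF (λ _ → φ) d ts        ≡⟨ sumF-++ (λ _ → φ) d f ts ⟨
  sumF (λ _ → φ) d (f ++ ts)                      ≡⟨ BFS⇒sumF≡sumC φ (pred m + length ts) d c ⟩
  sumC (λ _ → φ) (pred m + length ts) cs          ∎)
  where
  open ≡-Reasoning
  shift : ∀ {d} f → sumF (λ _ → φ) (suc d) f ≡ sumF (λ _ → φ) d f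
  shift [] = refl
  shift (node b ts ∷ f) = cong (φ b (length ts) +_) (cong₂ _+_ (shift ts) (shift f))

size : Forest → ℕ
size = sumF (λ _ _ _ → 1) 0

size-children : ∀ b ts f → size (node b ts ∷ f) ≡ suc (size (f ++ ts))
size-children b ts f = cong suc (begin
  sumF (λ _ _ _ → 1) 1 ts + size f  ≡⟨ cong (_+ size f) (shift 0 ts) ⟩
  size ts + size f                  ≡⟨ +-comm (size ts) (size f) ⟩
  size f + size ts                  ≡⟨ sumF-++ (λ _ _ _ → 1) 0 f ts ⟨
  size (f ++ ts)                    ∎)
  where
  open ≡-Reasoning
  shift : ∀ d f → sumF (λ _ _ _ → 1) (suc d) f ≡ sumF (λ _ _ _ → 1) d f
  shift d [] = refl
  shift d (node b ts ∷ f) = cong suc (cong₂ _+_ (shift (suc d) ts) (shift d f))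

bfs : ∀ f → ∃ λ cs → BFS f cs × length cs ≡ size f
bfs f = go (size f) f refl
  where
  -- The new queue `f ++ ts` is not a subterm of the old one, so the recursion is on the number of
  -- nodes left.
  go : ∀ n f → size f ≡ n → ∃ λ cs → BFS f cs × length cs ≡ n
  go zero    [] eq = [] , [] , refl
  go zero    (node _ _ ∷ _) ()
  go (suc n) (node b ts ∷ f) eq
    with go n (f ++ ts) (suc-injective (trans (sym (size-children b ts f)) eq))
  ... | cs , c , eq′ = _ , node b ts c , cong suc eq′

BFS-functional : ∀ {f cs ds} → BFS f cs → BFS f ds → cs ≡ ds
BFS-functional [] [] = refl
BFS-functional (node b ts c) (node .b .ts d) = cong (_ ∷_) (BFS-functional c d)

++-split : ∀ {A : Set} (xs ys zs ws : List A) → xs ++ zs ≡ ys ++ ws → length zs ≡ length ws → xs ≡ ys × zs ≡ ws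
++-split xs ys zs ws eq l = go xs ys eq (+-cancelʳ-≡ (length zs) (length xs) (length ys) (begin
    length xs + length zs  ≡⟨ length-++ xs ⟨
    length (xs ++ zs)      ≡⟨ cong length eq ⟩
    length (ys ++ ws)      ≡⟨ length-++ ys ⟩
    length ys + length ws  ≡⟨ cong (length ys +_) l ⟨
    length ys + length zs  ∎))
  where
  open ≡-Reasoning
  go : ∀ xs ys → xs ++ zs ≡ ys ++ ws → length xs ≡ length ys → xs ≡ ys × zs ≡ ws
  go [] [] eq l = refl , eq
  go (x ∷ xs) (y ∷ ys) eq l with ∷-injective eq
  ... | refl , eq′ with go xs ys eq′ (suc-injective l)
  ... | refl , refl = refl , refl

-- The rest of the code determines the queue `f ++ ts` by induction, and the recorded number of
-- children tells where to cut it.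
BFS-injective : ∀ {f g cs ds} → BFS f cs → BFS g ds → cs ≡ ds → f ≡ g
BFS-injective [] [] eq = refl
BFS-injective (node {f} b ts c) (node {g} b′ us d) eq
  with ∷-injective eq
... | eq₁ , eq₂ with cong proj₁ eq₁ | ++-split f g ts us (BFS-injective c d eq₂) (cong proj₂ eq₁)
... | refl | refl , refl = refl

-- The breadth-first code cut into levels, for inductions that advance by one depth at a time. The
-- constructor holds equations because unification cannot invert `children` or `_++_`.
data Levels : Forest → Code → Set where
  []    : Levels [] []
  level : ∀ {t f g cs ds} → children (t ∷ f) ≡ g → Levels g cs → ds ≡ roots (t ∷ f) ++ cs →
          Levels (t ∷ f) ds

-- Serving the nodes of `f` one by one leaves `g` at the front and collects the children behind it;
-- with `g` empty, exactly one level is consumed.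
BFS-roots : ∀ f {g cs} → BFS (f ++ g) cs → ∃ λ cs′ → cs ≡ roots f ++ cs′ × BFS (g ++ children f) cs′
BFS-roots [] {g} {cs} c = cs , refl , subst (λ g → BFS g cs) (sym (++-identityʳ g)) c
BFS-roots (node b ts ∷ f) {g} (node {cs = cs} .b .ts c)
  with BFS-roots f {g ++ ts} {cs} (subst (λ f → BFS f cs) (++-assoc f g ts) c)
... | cs′ , eq , c′ = cs′ , cong (_ ∷_) eq , subst (λ f → BFS f cs′) (++-assoc g ts (children f)) c′

length-roots : ∀ f → length (roots f) ≡ length f
length-roots [] = refl
length-roots (node b ts ∷ f) = cong suc (length-roots f)

levels : ∀ {f cs} → BFS f cs → Levels f cs
levels {f} {cs} c = go (length cs) c ≤-refl
  where
  go : ∀ n {f cs} → BFS f cs → length cs ≤ n → Levels f cs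
  go n [] l = []
  go (suc n) {t@(node _ _) ∷ f} {cs} c l
    with BFS-roots (t ∷ f) {[]} (subst (λ f → BFS f cs) (sym (++-identityʳ (t ∷ f))) c)
  ... | cs′ , refl , c′ = level refl (go n c′ (begin
      length cs′                      ≤⟨ m≤n+m (length cs′) (length (roots f)) ⟩
      length (roots f) + length cs′   ≡⟨ length-++ (roots f) ⟨
      length (roots f ++ cs′)         ≤⟨ ≤-pred l ⟩
      n                               ∎)) refl
    where open ≤-Reasoning

-- Statistics of the depth-first code

rowAreas : ℕ → List Step → List ℕ
rowAreas h []      = []
rowAreas h (N ∷ p) = h ∷ rowAreas (suc h) p
rowAreas h (E ∷ p) = rowAreas (pred h) p

areaWordAux≡rowAreas : ∀ h e p → DyckFrom h p → areaWordAux (h + e) e p ≡ rowAreas h p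
areaWordAux≡rowAreas h e [] d = refl
areaWordAux≡rowAreas h e (N ∷ p) d = cong₂ _∷_ (m+n∸n≡m h e) (areaWordAux≡rowAreas (suc h) e p d)
areaWordAux≡rowAreas (suc h) e (E ∷ p) d =
  trans (cong (λ k → areaWordAux k (suc e) p) (sym (+-suc h e))) (areaWordAux≡rowAreas h (suc e) p d)

areaWord≡rowAreas : ∀ p → DyckFrom 0 p → areaWord p ≡ rowAreas 0 p
areaWord≡rowAreas p = areaWordAux≡rowAreas 0 0 p

length-rowAreas : ∀ h p → length (rowAreas h p) ≡ norths p
length-rowAreas h []      = refl
length-rowAreas h (N ∷ p) = cong suc (length-rowAreas (suc h) p)
length-rowAreas h (E ∷ p) = length-rowAreas (pred h) p

-- Height is that of the midpoint of the rise; c is the flag of the preceding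
-- step if that is a north step, and false otherwise.
riseSum : (ℕ → ℕ) → Bool → ℕ → List NorthFlagged → ℕ
riseSum g c h []        = 0
riseSum g c h (↑ b ∷ s) = (if c then g h else 0) + riseSum g b (suc h) s
riseSum g c h (↓ ∷ s)   = riseSum g false (pred h) s

countTrue-∷ : ∀ b bs → countTrue (b ∷ bs) ≡ (if b then 1 else 0) + countTrue bs
countTrue-∷ true  bs = refl
countTrue-∷ false bs = refl

countTrue-rises : ∀ h s → countTrue (rises s) ≡ riseSum (const 1) false h s
countTrue-rises h [] = refl
countTrue-rises h (↓ ∷ s) = countTrue-rises (pred h) s
countTrue-rises h (↑ b ∷ s) = go b h s
  where
  go : ∀ b h s → countTrue (rises (↑ b ∷ s)) ≡ riseSum (const 1) b (suc h) s
  go b h [] = refl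
  go b h (↓ ∷ s) = countTrue-rises h s
  go b h (↑ c ∷ s) = trans (countTrue-∷ b _) (cong ((if b then 1 else 0) +_) (go c (suc h) s))

decoratedRiseAreas : List ℕ → List Bool → ℕ
decoratedRiseAreas w dr = sum (map (λ j → if atB dr j then atℕ w (suc j) else 0) (upTo (length w)))

decoratedRiseAreas-∷ : ∀ x w c dr → decoratedRiseAreas (x ∷ w) (c ∷ dr) ≡
                       (if c then atℕ w 0 else 0) + decoratedRiseAreas w dr
decoratedRiseAreas-∷ x w c dr =
  trans (cong sum (map-upTo (λ j → if atB (c ∷ dr) j then atℕ (x ∷ w) (suc j) else 0) (length (x ∷ w))))
        (cong ((if c then atℕ w 0 else 0) +_)
              (cong sum (sym (map-upTo (λ j → if atB dr j then atℕ w (suc j) else 0) (length w)))))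

decoratedRiseAreas≡riseSum : ∀ h s → decoratedRiseAreas (rowAreas h (steps s)) (rises s) ≡ riseSum id false h s
decoratedRiseAreas≡riseSum h [] = refl
decoratedRiseAreas≡riseSum h (↓ ∷ s) = decoratedRiseAreas≡riseSum (pred h) s
decoratedRiseAreas≡riseSum h (↑ b ∷ s) = go b h s
  where
  go : ∀ b h s → decoratedRiseAreas (rowAreas h (steps (↑ b ∷ s))) (rises (↑ b ∷ s)) ≡ riseSum id b (suc h) s
  go b h [] = refl
  go b h (↓ ∷ s) = trans (decoratedRiseAreas-∷ h (rowAreas h (steps s)) false (rises s)) (decoratedRiseAreas≡riseSum h s)
  go b h (↑ c ∷ s) = trans (decoratedRiseAreas-∷ h (rowAreas (suc h) (N ∷ steps s)) b (rises (↑ c ∷ s)))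
                           (cong ((if b then suc h else 0) +_) (go c (suc h) s))

areaR-toRaw : ∀ s → DyckFrom 0 (steps s) →
              areaR (toRaw s) ≡ sum (rowAreas 0 (steps s)) ∸ riseSum id false 0 s
areaR-toRaw s d = begin
  areaR (toRaw s)
    ≡⟨ cong (λ w → sum w ∸ decoratedRiseAreas w (rises s)) (areaWord≡rowAreas (steps s) d) ⟩
  sum (rowAreas 0 (steps s)) ∸ decoratedRiseAreas (rowAreas 0 (steps s)) (rises s)
    ≡⟨ cong (sum (rowAreas 0 (steps s)) ∸_) (decoratedRiseAreas≡riseSum 0 s) ⟩
  sum (rowAreas 0 (steps s)) ∸ riseSum id false 0 s ∎
  where open ≡-Reasoning

isLeaf : ℕ → Bool
isLeaf k = k ≡ᵇ 0

leafFlag innerFlag : Bool → ℕ → Bool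
leafFlag  b k = isLeaf k ∧ b
innerFlag b k = not (isLeaf k) ∧ b

indicator : Bool → ℕ
indicator b = if b then 1 else 0

-- A flagged node makes a rise exactly if its first child follows, and the rise has the height of
-- that child. The flag `c` of the step before the forest is settled by the first root; if there is
-- none, the hypothesis says that `s` does not see it either.
riseSum-dfs : ∀ g c d f s → riseSum g c d s ≡ riseSum g false d s →
              riseSum g c d (dfs f s) ≡
              (if innerFlag c (length f) then g d else 0) +
              (sumF (λ d b k → if innerFlag b k then g (suc d) else 0) d f + riseSum g false d s)
riseSum-dfs g c d [] s eq = eq
riseSum-dfs g c d (node b ts ∷ f) s eq = cong ((if c then g d else 0) +_) (begin
  riseSum g b (suc d) (dfs ts (↓ ∷ dfs f s))
    ≡⟨ riseSum-dfs g b (suc d) ts (↓ ∷ dfs f s) refl ⟩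
  i + (u + riseSum g false d (dfs f s))
    ≡⟨ cong (λ x → i + (u + x)) (riseSum-dfs g false d f s refl) ⟩
  i + (u + ((if innerFlag false (length f) then g d else 0) + (v + r)))
    -- The next sibling comes after the east step that closes the current node, so it completes no
    -- rise.
    ≡⟨ cong (λ x → i + (u + (x + (v + r)))) (noRise (length f)) ⟩
  i + (u + (v + r))
    ≡⟨ solve-assoc i u v r ⟩
  i + (u + v) + r ∎)
  where
  open ≡-Reasoning
  φ : ℕ → Bool → ℕ → ℕ
  φ = λ d b k → if innerFlag b k then g (suc d) else 0
  i = φ d b (length ts)
  u = sumF φ (suc d) ts
  v = sumF φ d f
  r = riseSum g false d s
  noRise : ∀ k → (if innerFlag false k then g d else 0) ≡ 0
  noRise zero    = refl
  noRise (suc k) = refl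
  solve-assoc : ∀ i u v r → i + (u + (v + r)) ≡ i + (u + v) + r
  solve-assoc = solve-∀

riseSum-dfs-[] : ∀ g f → riseSum g false 0 (dfs f []) ≡
                 sumF (λ d b k → if innerFlag b k then g (suc d) else 0) 0 f
riseSum-dfs-[] g f = trans (riseSum-dfs g false 0 f [] refl) (go (length f) _)
  where
  go : ∀ k x → (if innerFlag false k then g 0 else 0) + (x + 0) ≡ x
  go zero    x = +-identityʳ x
  go (suc k) x = +-identityʳ x

record Row : Set where
  constructor row
  field
    depth      : ℕ
    dec peak   : Bool
open Row

preRows : ℕ → Forest → List Row → List Row
preRows d []              w = w
preRows d (node b ts ∷ f) w =
  row d (leafFlag b (length ts)) (isLeaf (length ts)) ∷ preRows (suc d) ts (preRows d f w)

record RowsOf (h : ℕ) (s : List NorthFlagged) (w : List Row) : Set where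
  field
    depths : rowAreas h (steps s) ≡ map depth w
    decs   : peaks s ≡ map dec w
    flags  : peakFlags (steps s) ≡ map peak w

preRows-dfs : ∀ d f s w → RowsOf d s w → RowsOf d (dfs f s) (preRows d f w)
preRows-dfs d [] s w ok = ok
preRows-dfs d (node b ts ∷ f) s w ok = record
  { depths = cong (d ∷_) depths
  ; decs   = trans (peaks-↑ ts) (cong (_ ∷_) decs)
  ; flags  = trans (peakFlags-↑ ts) (cong (_ ∷_) flags)
  }
  where
  rest : RowsOf (suc d) (↓ ∷ dfs f s) (preRows d f w)
  rest = record { RowsOf (preRows-dfs d f s w ok) }
  open RowsOf (preRows-dfs (suc d) ts (↓ ∷ dfs f s) (preRows d f w) rest)
  peaks-↑ : ∀ ts → peaks (↑ b ∷ dfs ts (↓ ∷ dfs f s)) ≡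
            leafFlag b (length ts) ∷ peaks (dfs ts (↓ ∷ dfs f s))
  peaks-↑ []             = refl
  peaks-↑ (node _ _ ∷ _) = refl
  peakFlags-↑ : ∀ ts → peakFlags (N ∷ steps (dfs ts (↓ ∷ dfs f s))) ≡
                isLeaf (length ts) ∷ peakFlags (steps (dfs ts (↓ ∷ dfs f s)))
  peakFlags-↑ []             = refl
  peakFlags-↑ (node _ _ ∷ _) = refl

dfs-rows : ∀ f → RowsOf 0 (dfs f []) (preRows 0 f [])
dfs-rows f = preRows-dfs 0 f [] [] (record { depths = refl ; decs = refl ; flags = refl })

preRows-sum : ∀ φ (ψ : Row → ℕ) → (∀ d b k → ψ (row d (leafFlag b k) (isLeaf k)) ≡ φ d b k) →
               ∀ d f w → sum (map ψ (preRows d f w)) ≡ sumF φ d f + sum (map ψ w)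
preRows-sum φ ψ eq d [] w = refl
preRows-sum φ ψ eq d (node b ts ∷ f) w
  rewrite eq d b (length ts) | preRows-sum φ ψ eq (suc d) ts (preRows d f w) | preRows-sum φ ψ eq d f w =
  solve-assoc (φ d b (length ts)) (sumF φ (suc d) ts) (sumF φ d f) (sum (map ψ w))
  where
  solve-assoc : ∀ w x y z → w + (x + (y + z)) ≡ w + (x + y) + z
  solve-assoc = solve-∀

countTrue-map : ∀ w → countTrue (map dec w) ≡ sum (map (indicator ∘ dec) w)
countTrue-map [] = refl
countTrue-map (row d b l ∷ w) = trans (countTrue-∷ b _) (cong (indicator b +_) (countTrue-map w))

dfs-#peaks : ∀ f → countTrue (peaks (dfs f [])) ≡ sumF (λ _ b k → indicator (leafFlag b k)) 0 f
dfs-#peaks f = begin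
  countTrue (peaks (dfs f []))              ≡⟨ cong countTrue (RowsOf.decs (dfs-rows f)) ⟩
  countTrue (map dec w)                     ≡⟨ countTrue-map w ⟩
  sum (map (indicator ∘ dec) w)             ≡⟨ preRows-sum _ _ (λ _ _ _ → refl) 0 f [] ⟩
  sumF (λ _ b k → indicator (leafFlag b k)) 0 f + 0 ≡⟨ +-identityʳ _ ⟩
  sumF (λ _ b k → indicator (leafFlag b k)) 0 f     ∎
  where
  open ≡-Reasoning
  w = preRows 0 f []

dfs-#rises : ∀ f → countTrue (rises (dfs f [])) ≡ sumF (λ _ b k → indicator (innerFlag b k)) 0 f
dfs-#rises f = trans (countTrue-rises 0 (dfs f [])) (riseSum-dfs-[] (const 1) f)

dfs-size : ∀ f → norths (steps (dfs f [])) ≡ size f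
dfs-size f = begin
  norths (steps (dfs f []))                  ≡⟨ length-rowAreas 0 (steps (dfs f [])) ⟨
  length (rowAreas 0 (steps (dfs f [])))     ≡⟨ cong length (RowsOf.depths (dfs-rows f)) ⟩
  length (map depth w)                       ≡⟨ len w ⟩
  sum (map (const 1) w)                      ≡⟨ preRows-sum _ _ (λ _ _ _ → refl) 0 f [] ⟩
  size f + 0                                 ≡⟨ +-identityʳ _ ⟩
  size f                                     ∎
  where
  open ≡-Reasoning
  w = preRows 0 f []
  len : ∀ w → length (map depth w) ≡ sum (map (const 1) w)
  len []      = refl
  len (_ ∷ w) = cong suc (len w)

-- The number of children of a node that are not the last child of a
-- decorated node.
undecorated : Bool → ℕ → ℕ
undecorated b zero    = 0
undecorated b (suc k) = (if b then 0 else 1) + k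

undecorated+innerFlag : ∀ b k → k ≡ undecorated b k + indicator (innerFlag b k)
undecorated+innerFlag b     zero    = refl
undecorated+innerFlag false (suc k) = cong suc (sym (+-identityʳ k))
undecorated+innerFlag true  (suc k) = +-comm 1 k

areaF : Forest → ℕ
areaF = sumF (λ d b k → suc d * undecorated b k) 0

-- A node with `k` children of depth `suc d` accounts for `suc d * k` squares; if it is decorated,
-- its rise cancels the row of the first child, and `undecorated b k` children remain.
dfs-area : ∀ f → areaR (toRaw (dfs f [])) ≡ areaF f
dfs-area f = begin
  areaR (toRaw (dfs f []))
    ≡⟨ areaR-toRaw (dfs f []) (dfs-dyck 0 f [] tt) ⟩
  sum (rowAreas 0 (steps (dfs f []))) ∸ riseSum id false 0 (dfs f [])
    ≡⟨ cong₂ _∸_ totalArea (riseSum-dfs-[] id f) ⟩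
  areaF f + R ∸ R
    ≡⟨ m+n∸n≡m (areaF f) R ⟩
  areaF f ∎
  where
  open ≡-Reasoning
  φ : ℕ → Bool → ℕ → ℕ
  φ = λ d b k → if innerFlag b k then suc d else 0
  R = sumF φ 0 f
  split : ∀ d b k → suc d * k ≡ suc d * undecorated b k + φ d b k
  split d b k = begin
    suc d * k                                                        ≡⟨ cong (suc d *_) (undecorated+innerFlag b k) ⟩
    suc d * (undecorated b k + indicator (innerFlag b k))            ≡⟨ *-distribˡ-+ (suc d) (undecorated b k) _ ⟩
    suc d * undecorated b k + suc d * indicator (innerFlag b k)      ≡⟨ cong (suc d * undecorated b k +_) (times (innerFlag b k)) ⟩
    suc d * undecorated b k + φ d b k                                ∎
    where
    times : ∀ c → suc d * indicator c ≡ (if c then suc d else 0)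
    times true  = *-identityʳ (suc d)
    times false = *-zeroʳ (suc d)
  totalArea : sum (rowAreas 0 (steps (dfs f []))) ≡ areaF f + R
  totalArea = begin
    sum (rowAreas 0 (steps (dfs f [])))          ≡⟨ cong sum (RowsOf.depths (dfs-rows f)) ⟩
    sum (map depth (preRows 0 f []))            ≡⟨ preRows-sum (λ d _ _ → d) depth (λ _ _ _ → refl) 0 f [] ⟩
    sumF (λ d _ _ → d) 0 f + 0                   ≡⟨ +-identityʳ _ ⟩
    sumF (λ d _ _ → d) 0 f                       ≡⟨ sumF-depth 0 f ⟩
    sumF (λ d _ k → suc d * k) 0 f               ≡⟨ sumF-cong split 0 f ⟩
    sumF (λ d b k → suc d * undecorated b k + φ d b k) 0 f ≡⟨ sumF-+ (λ d b k → suc d * undecorated b k) φ 0 f ⟩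
    areaF f + R                                  ∎

-- The dinv of the depth-first code

Σ< : ℕ → (ℕ → ℕ) → ℕ
Σ< n f = sum (applyUpTo f n)

Σ<-cong : ∀ n {f g} → (∀ i → f i ≡ g i) → Σ< n f ≡ Σ< n g
Σ<-cong zero    eq = refl
Σ<-cong (suc n) eq = cong₂ _+_ (eq 0) (Σ<-cong n (eq ∘ suc))

attacks : Row → Row → ℕ
attacks x y = indicator (((depth x ≡ᵇ depth y) ∧ not (dec x)) ∨ ((depth x ≡ᵇ suc (depth y)) ∧ not (dec y)))

dinvRows : List Row → ℕ
dinvRows []      = 0
dinvRows (x ∷ w) = sum (map (attacks x) w) + dinvRows w

pairCount : List ℕ → List Bool → ℕ → ℕ → ℕ
pairCount w dp i j =
  indicator ((i <ᵇ j) ∧ ( ((atℕ w i ≡ᵇ atℕ w j) ∧ not (atB dp i))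
                        ∨ ((atℕ w i ≡ᵇ suc (atℕ w j)) ∧ not (atB dp j)) ))

pairSum≡dinvRows : ∀ w →
  Σ< (length (map depth w)) (λ i → Σ< (length (map depth w)) (pairCount (map depth w) (map dec w) i)) ≡ dinvRows w
pairSum≡dinvRows []      = refl
pairSum≡dinvRows (x ∷ w) = cong₂ _+_ (first w) (pairSum≡dinvRows w)
  where
  first : ∀ v → Σ< (length (map depth v)) (λ j → pairCount (map depth (x ∷ v)) (map dec (x ∷ v)) 0 (suc j)) ≡
          sum (map (attacks x) v)
  first []      = refl
  first (y ∷ v) = cong (attacks x y +_) (first v)

dinvR≡dinvRows : ∀ s w → DyckFrom 0 (steps s) → RowsOf 0 s w → dinvR (toRaw s) ≡ dinvRows w
dinvR≡dinvRows s w d ok = begin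
  dinvR (toRaw s)                               ≡⟨ doubleSum (areaWord (steps s)) (peaks s) ⟩
  pairSum (areaWord (steps s)) (peaks s)        ≡⟨ cong₂ pairSum (trans (areaWord≡rowAreas (steps s) d) depths) decs ⟩
  pairSum (map depth w) (map dec w)             ≡⟨ pairSum≡dinvRows w ⟩
  dinvRows w                                    ∎
  where
  open ≡-Reasoning
  open RowsOf ok
  pairSum : List ℕ → List Bool → ℕ
  pairSum v dp = Σ< (length v) (λ i → Σ< (length v) (pairCount v dp i))
  doubleSum : ∀ v dp → sum (map (λ i → sum (map (pairCount v dp i) (upTo (length v)))) (upTo (length v))) ≡ pairSum v dp
  doubleSum v dp = trans (cong sum (map-upTo _ (length v)))
                         (Σ<-cong (length v) (λ i → cong sum (map-upTo (pairCount v dp i) (length v))))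

strip : List Row → List Row
strip []                    = []
strip (row zero _ _ ∷ w)    = strip w
strip (row (suc d) b l ∷ w) = row d b l ∷ strip w

preRows-++ : ∀ d f g w → preRows d (f ++ g) w ≡ preRows d f (preRows d g w)
preRows-++ d [] g w = refl
preRows-++ d (node b ts ∷ f) g w = cong (λ v → _ ∷ preRows (suc d) ts v) (preRows-++ d f g w)

strip-preRows-suc : ∀ d f w → strip (preRows (suc d) f w) ≡ preRows d f (strip w)
strip-preRows-suc d [] w = refl
strip-preRows-suc d (node b ts ∷ f) w =
  cong (_ ∷_) (trans (strip-preRows-suc (suc d) ts _) (cong (preRows (suc d) ts) (strip-preRows-suc d f w)))

-- Without its roots a pre-order list is that of the forest of children, so statistics of rows can
-- be computed by induction on the levels.
strip-preRows : ∀ f w → strip (preRows 0 f w) ≡ preRows 0 (children f) (strip w)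
strip-preRows [] w = refl
strip-preRows (node b ts ∷ f) w = begin
  strip (preRows 1 ts (preRows 0 f w))              ≡⟨ strip-preRows-suc 0 ts _ ⟩
  preRows 0 ts (strip (preRows 0 f w))              ≡⟨ cong (preRows 0 ts) (strip-preRows f w) ⟩
  preRows 0 ts (preRows 0 (children f) (strip w))   ≡⟨ preRows-++ 0 ts (children f) (strip w) ⟨
  preRows 0 (ts ++ children f) (strip w)            ∎
  where open ≡-Reasoning

zeros : List Row → ℕ
zeros []                    = 0
zeros (row zero _ _ ∷ w)    = suc (zeros w)
zeros (row (suc _) _ _ ∷ w) = zeros w

undecoratedZeros : List Row → ℕ
undecoratedZeros []                    = 0
undecoratedZeros (row zero b _ ∷ w)    = indicator (not b) + undecoratedZeros w
undecoratedZeros (row (suc _) _ _ ∷ w) = undecoratedZeros w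

-- The dinv pairs involving a row of depth 0, counted at the undecorated row
-- of depth 0 that makes them count; a is the number of rows of depth 1
-- already met.
rootDinv : ℕ → List Row → ℕ
rootDinv a []                          = 0
rootDinv a (row zero b _ ∷ w)          = (if b then 0 else a + zeros w) + rootDinv a w
rootDinv a (row (suc zero) _ _ ∷ w)    = rootDinv (suc a) w
rootDinv a (row (suc (suc _)) _ _ ∷ w) = rootDinv a w

-- One more earlier row of depth 1 forms one more counted pair with each undecorated root still to
-- come.
rootDinv-suc : ∀ a w → rootDinv (suc a) w ≡ undecoratedZeros w + rootDinv a w
rootDinv-suc a [] = refl
rootDinv-suc a (row zero true _ ∷ w) = rootDinv-suc a w
rootDinv-suc a (row zero false _ ∷ w) rewrite rootDinv-suc a w =
  solve-assoc a (zeros w) (undecoratedZeros w) (rootDinv a w)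
  where
  solve-assoc : ∀ a z u r → suc (a + z + (u + r)) ≡ suc (u + (a + z + r))
  solve-assoc = solve-∀
rootDinv-suc a (row (suc zero) _ _ ∷ w) = rootDinv-suc (suc a) w
rootDinv-suc a (row (suc (suc _)) _ _ ∷ w) = rootDinv-suc a w

-- Pairs of positive depths survive in `strip w`, since `attacks` compares depths only relative to
-- each other. The remaining ones are two roots, or a row of depth 1 before a root, and these are
-- what `rootDinv` counts.
dinvRows-strip : ∀ w → dinvRows w ≡ rootDinv 0 w + dinvRows (strip w)
dinvRows-strip [] = refl
dinvRows-strip (x@(row zero b l) ∷ w) =
  trans (cong₂ _+_ (zero-attacks b w) (dinvRows-strip w))
        (sym (+-assoc (if b then 0 else zeros w) (rootDinv 0 w) (dinvRows (strip w))))
  where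
  zero-attacks : ∀ b v → sum (map (attacks (row zero b l)) v) ≡ (if b then 0 else zeros v)
  zero-attacks true  []                      = refl
  zero-attacks false []                      = refl
  zero-attacks true  (row zero _ _ ∷ v)      = zero-attacks true v
  zero-attacks false (row zero _ _ ∷ v)      = cong suc (zero-attacks false v)
  zero-attacks true  (row (suc _) _ _ ∷ v)   = zero-attacks true v
  zero-attacks false (row (suc _) _ _ ∷ v)   = zero-attacks false v
dinvRows-strip (x@(row (suc zero) b l) ∷ w) = begin
  sum (map (attacks x) w) + dinvRows w
    ≡⟨ cong₂ _+_ (one-attacks w) (dinvRows-strip w) ⟩
  undecoratedZeros w + u + (rootDinv 0 w + dinvRows (strip w))
    ≡⟨ solve-assoc (undecoratedZeros w) u (rootDinv 0 w) (dinvRows (strip w)) ⟩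
  undecoratedZeros w + rootDinv 0 w + (u + dinvRows (strip w))
    ≡⟨ cong (_+ (u + dinvRows (strip w))) (rootDinv-suc 0 w) ⟨
  rootDinv 1 w + (u + dinvRows (strip w)) ∎
  where
  open ≡-Reasoning
  u = sum (map (attacks (row zero b l)) (strip w))
  solve-assoc : ∀ z u r v → z + u + (r + v) ≡ z + r + (u + v)
  solve-assoc = solve-∀
  swap : ∀ z a u → a + (z + u) ≡ z + (a + u)
  swap = solve-∀
  one-attacks : ∀ v → sum (map (attacks x) v) ≡ undecoratedZeros v + sum (map (attacks (row zero b l)) (strip v))
  one-attacks [] = refl
  one-attacks (row zero c _ ∷ v) =
    trans (cong (indicator (not c) +_) (one-attacks v)) (sym (+-assoc (indicator (not c)) (undecoratedZeros v) _))
  one-attacks (y@(row (suc d) c m) ∷ v) =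
    trans (cong (attacks x y +_) (one-attacks v))
          (swap (undecoratedZeros v) (attacks x y) _)
dinvRows-strip (x@(row (suc (suc e)) b l) ∷ w) = begin
  sum (map (attacks x) w) + dinvRows w
    ≡⟨ cong₂ _+_ (deep-attacks w) (dinvRows-strip w) ⟩
  u + (rootDinv 0 w + dinvRows (strip w))
    ≡⟨ swap (rootDinv 0 w) u (dinvRows (strip w)) ⟩
  rootDinv 0 w + (u + dinvRows (strip w)) ∎
  where
  open ≡-Reasoning
  u = sum (map (attacks (row (suc e) b l)) (strip w))
  swap : ∀ z a u → a + (z + u) ≡ z + (a + u)
  swap = solve-∀
  deep-attacks : ∀ v → sum (map (attacks x) v) ≡ sum (map (attacks (row (suc e) b l)) (strip v))
  deep-attacks [] = refl
  deep-attacks (row zero c _ ∷ v) = deep-attacks v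
  deep-attacks (y@(row (suc d) c m) ∷ v) = cong (attacks x y +_) (deep-attacks v)

zeros-preRows-suc : ∀ d f w → zeros (preRows (suc d) f w) ≡ zeros w
zeros-preRows-suc d [] w = refl
zeros-preRows-suc d (node b ts ∷ f) w = trans (zeros-preRows-suc (suc d) ts _) (zeros-preRows-suc d f w)

zeros-preRows : ∀ f w → zeros (preRows 0 f w) ≡ length f + zeros w
zeros-preRows [] w = refl
zeros-preRows (node b ts ∷ f) w = cong suc (trans (zeros-preRows-suc 0 ts _) (zeros-preRows f w))

rootDinv-preRows-2+ : ∀ a d f w → rootDinv a (preRows (2 + d) f w) ≡ rootDinv a w
rootDinv-preRows-2+ a d [] w = refl
rootDinv-preRows-2+ a d (node b ts ∷ f) w =
  trans (rootDinv-preRows-2+ a (suc d) ts _) (rootDinv-preRows-2+ a d f w)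

-- Of the proper descendants of a root only its children have depth 1, and all of them precede the
-- next root.
rootDinv-preRows-1 : ∀ a f w → rootDinv a (preRows 1 f w) ≡ rootDinv (a + length f) w
rootDinv-preRows-1 a [] w = cong (λ a → rootDinv a w) (sym (+-identityʳ a))
rootDinv-preRows-1 a (node b ts ∷ f) w = begin
  rootDinv (suc a) (preRows 2 ts (preRows 1 f w))  ≡⟨ rootDinv-preRows-2+ (suc a) 0 ts _ ⟩
  rootDinv (suc a) (preRows 1 f w)                 ≡⟨ rootDinv-preRows-1 (suc a) f w ⟩
  rootDinv (suc a + length f) w                    ≡⟨ cong (λ a → rootDinv a w) (+-suc a (length f)) ⟨
  rootDinv (a + suc (length f)) w                  ∎
  where open ≡-Reasoning

φ-dinv : ℕ → Bool → ℕ → ℕ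
φ-dinv q b k = if leafFlag b k then 0 else q

-- With a children already in the queue behind the remaining roots f, the
-- removal of a root leaves the queue length that rootDinv counts.
rootDinv≡sumC : ∀ a f cs → sumC φ-dinv (length f + a) (roots f ++ cs) ≡
                rootDinv a (preRows 0 f []) + sumC φ-dinv (a + length (children f)) cs
rootDinv≡sumC a [] cs = cong (λ a → sumC φ-dinv a cs) (sym (+-identityʳ a))
rootDinv≡sumC a (node b ts ∷ f) cs = begin
  φ-dinv (length f + a) b k + sumC φ-dinv (length f + a + k) (roots f ++ cs)
    ≡⟨ cong₂ (λ x y → φ-dinv x b k + sumC φ-dinv y (roots f ++ cs)) queue (+-assoc (length f) a k) ⟩
  φ-dinv (a + zeros rest) b k + sumC φ-dinv (length f + (a + k)) (roots f ++ cs)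
    ≡⟨ cong (φ-dinv (a + zeros rest) b k +_) (rootDinv≡sumC (a + k) f cs) ⟩
  φ-dinv (a + zeros rest) b k + (rootDinv (a + k) (preRows 0 f []) + sumC φ-dinv (a + k + length (children f)) cs)
    ≡⟨ +-assoc (φ-dinv (a + zeros rest) b k) _ _ ⟨
  φ-dinv (a + zeros rest) b k + rootDinv (a + k) (preRows 0 f []) + sumC φ-dinv (a + k + length (children f)) cs
    ≡⟨ cong₂ (λ x y → φ-dinv (a + zeros rest) b k + x + sumC φ-dinv y cs)
             (sym (rootDinv-preRows-1 a ts (preRows 0 f [])))
             (trans (+-assoc a k _) (cong (a +_) (sym (length-++ ts)))) ⟩
  φ-dinv (a + zeros rest) b k + rootDinv a rest + sumC φ-dinv (a + length (ts ++ children f)) cs ∎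
  where
  open ≡-Reasoning
  k = length ts
  rest = preRows 1 ts (preRows 0 f [])
  queue : length f + a ≡ a + zeros rest
  queue = trans (+-comm (length f) a)
    (cong (a +_) (sym (trans (zeros-preRows-suc 0 ts _) (trans (zeros-preRows f []) (+-identityʳ _)))))

-- Level by level: the pairs that involve a root are the queue lengths met while the roots are
-- served, and what is left is the dinv of the forest of children, whose roots then form the queue.
dinvRows≡sumC : ∀ {f cs} → Levels f cs → dinvRows (preRows 0 f []) ≡ sumC φ-dinv (length f) cs
dinvRows≡sumC [] = refl
dinvRows≡sumC (level {t} {f} {cs = cs} refl l refl) = begin
  dinvRows (preRows 0 F [])
    ≡⟨ dinvRows-strip (preRows 0 F []) ⟩
  rootDinv 0 (preRows 0 F []) + dinvRows (strip (preRows 0 F []))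
    ≡⟨ cong (λ w → rootDinv 0 (preRows 0 F []) + dinvRows w) (strip-preRows F []) ⟩
  rootDinv 0 (preRows 0 F []) + dinvRows (preRows 0 (children F) [])
    ≡⟨ cong (rootDinv 0 (preRows 0 F []) +_) (dinvRows≡sumC l) ⟩
  rootDinv 0 (preRows 0 F []) + sumC φ-dinv (length (children F)) cs
    ≡⟨ rootDinv≡sumC 0 F cs ⟨
  sumC φ-dinv (length F + 0) (roots F ++ cs)
    ≡⟨ cong (λ m → sumC φ-dinv m (roots F ++ cs)) (+-identityʳ (length F)) ⟩
  sumC φ-dinv (length F) (roots F ++ cs) ∎
  where
  open ≡-Reasoning
  F = t ∷ f

dfs-dinv : ∀ {f cs} → BFS f cs → dinvR (toRaw (dfs f [])) ≡ sumC φ-dinv (length f) cs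
dfs-dinv {f} c =
  trans (dinvR≡dinvRows (dfs f []) (preRows 0 f []) (dfs-dyck 0 f [] tt) (dfs-rows f))
        (dinvRows≡sumC (levels c))

-- The rightmost highest peak

pickLast : (ℕ → Bool) → ℕ → ℕ → ℕ
pickLast c r acc = if c r then (if r <ᵇ acc then acc else r) else acc

pickLast-none : ∀ c g n → or (applyUpTo (c ∘ g) n) ≡ false → foldr (pickLast c) 0 (applyUpTo g n) ≡ 0
pickLast-none c g zero eq = refl
pickLast-none c g (suc n) eq with c (g 0)
pickLast-none c g (suc n) () | true
... | false = pickLast-none c (g ∘ suc) n eq

-- The start value 0 of the fold stands both for the first row and for no row at all, so shifting
-- the indices shifts the result only if some row is picked.
pickLast-suc : ∀ c g n → foldr (pickLast c) 0 (applyUpTo (suc ∘ g) n) ≡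
               (if or (applyUpTo (c ∘ suc ∘ g) n) then suc (foldr (pickLast (c ∘ suc)) 0 (applyUpTo g n)) else 0)
pickLast-suc c g zero = refl
pickLast-suc c g (suc n)
  rewrite pickLast-suc c (g ∘ suc) n
  with c (suc (g 0)) | or (applyUpTo (c ∘ suc ∘ g ∘ suc) n) in eq
... | false | _     = refl
... | true  | false rewrite pickLast-none (c ∘ suc) (g ∘ suc) n eq = refl
... | true  | true with g 0 <ᵇ foldr (pickLast (c ∘ suc)) 0 (applyUpTo (g ∘ suc) n)
...   | true  = refl
...   | false = refl

highestPeak : ℕ → Row → Bool
highestPeak m x = peak x ∧ (depth x ≡ᵇ m)

someHighest : ℕ → List Row → Bool
someHighest m w = or (map (highestPeak m) w)

-- Meaningful only if some row is a peak of depth m.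
lastHighest : ℕ → List Row → Bool
lastHighest m []      = false
lastHighest m (x ∷ w) = if someHighest m w then lastHighest m w else dec x

maxPeakDepth : List Row → ℕ
maxPeakDepth []      = 0
maxPeakDepth (x ∷ w) = (if peak x then depth x else 0) ⊔ maxPeakDepth w

maxPeakW≡ : ∀ w →
  foldr _⊔_ 0 (map (λ r → if atB (map peak w) r then atℕ (map depth w) r else 0) (upTo (length (map depth w)))) ≡
  maxPeakDepth w
maxPeakW≡ w = trans (cong (foldr _⊔_ 0) (map-upTo _ (length (map depth w)))) (go w)
  where
  go : ∀ w → foldr _⊔_ 0 (applyUpTo (λ r → if atB (map peak w) r then atℕ (map depth w) r else 0) (length (map depth w)))
       ≡ maxPeakDepth w
  go []      = refl
  go (x ∷ w) = cong ((if peak x then depth x else 0) ⊔_) (go w)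

highestAt : ℕ → List Row → ℕ → Bool
highestAt m w r = atB (map peak w) r ∧ (atℕ (map depth w) r ≡ᵇ m)

someHighest≡ : ∀ m w → or (applyUpTo (highestAt m w) (length (map depth w))) ≡ someHighest m w
someHighest≡ m []      = refl
someHighest≡ m (x ∷ w) = cong (highestPeak m x ∨_) (someHighest≡ m w)

lastHighest≡ : ∀ m w → atB (map dec w) (foldr (pickLast (highestAt m w)) 0 (upTo (length (map depth w)))) ≡ lastHighest m w
lastHighest≡ m [] = refl
lastHighest≡ m (x ∷ w) = trans (cong (atB (map dec (x ∷ w))) first) pick
  where
  n = length (map depth w)
  acc = foldr (pickLast (highestAt m (x ∷ w))) 0 (applyUpTo suc n)
  first : pickLast (highestAt m (x ∷ w)) 0 acc ≡
          (if someHighest m w then suc (foldr (pickLast (highestAt m w)) 0 (upTo n)) else 0)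
  first = trans absorb (trans (pickLast-suc (highestAt m (x ∷ w)) id n)
    (cong (λ b → if b then suc (foldr (pickLast (highestAt m w)) 0 (upTo n)) else 0) (someHighest≡ m w)))
    where
    absorb : pickLast (highestAt m (x ∷ w)) 0 acc ≡ acc
    absorb with highestPeak m x | acc
    ... | true  | zero  = refl
    ... | true  | suc _ = refl
    ... | false | _     = refl
  pick : atB (map dec (x ∷ w)) (if someHighest m w then suc (foldr (pickLast (highestAt m w)) 0 (upTo n)) else 0) ≡
         lastHighest m (x ∷ w)
  pick with someHighest m w
  ... | true  = lastHighest≡ m w
  ... | false = refl

rightmostHighestPeak≡ : ∀ s w → DyckFrom 0 (steps s) → RowsOf 0 s w →
  atB (peaks s) (rightmostHighestPeak (steps s)) ≡ lastHighest (maxPeakDepth w) w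
rightmostHighestPeak≡ s w d ok = begin
  atB (peaks s) (rightmostHighestPeak (steps s))
    ≡⟨⟩
  value (peakFlags (steps s)) (areaWord (steps s)) (peaks s) (maxW (peakFlags (steps s)) (areaWord (steps s)))
    ≡⟨ cong (λ v → value (peakFlags (steps s)) v (peaks s) (maxW (peakFlags (steps s)) v))
            (trans (areaWord≡rowAreas (steps s) d) depths) ⟩
  value (peakFlags (steps s)) (map depth w) (peaks s) (maxW (peakFlags (steps s)) (map depth w))
    ≡⟨ cong₂ (λ pf dp → value pf (map depth w) dp (maxW pf (map depth w))) flags decs ⟩
  value (map peak w) (map depth w) (map dec w) (maxW (map peak w) (map depth w))
    ≡⟨ cong (value (map peak w) (map depth w) (map dec w)) (maxPeakW≡ w) ⟩
  value (map peak w) (map depth w) (map dec w) (maxPeakDepth w)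
    ≡⟨ lastHighest≡ (maxPeakDepth w) w ⟩
  lastHighest (maxPeakDepth w) w ∎
  where
  open ≡-Reasoning
  open RowsOf ok
  maxW : List Bool → List ℕ → ℕ
  maxW pf v = foldr _⊔_ 0 (map (λ r → if atB pf r then atℕ v r else 0) (upTo (length v)))
  value : List Bool → List ℕ → List Bool → ℕ → Bool
  value pf v dp m = atB dp (foldr (pickLast (λ r → atB pf r ∧ (atℕ v r ≡ᵇ m))) 0 (upTo (length v)))

someHighest-strip : ∀ m w → someHighest (suc m) w ≡ someHighest m (strip w)
someHighest-strip m [] = refl
someHighest-strip m (row zero b false ∷ w)    = someHighest-strip m w
someHighest-strip m (row zero b true ∷ w)     = someHighest-strip m w
someHighest-strip m (row (suc d) b false ∷ w) = someHighest-strip m w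
someHighest-strip m (row (suc d) b true ∷ w)  = cong ((d ≡ᵇ m) ∨_) (someHighest-strip m w)

lastHighest-strip : ∀ m w → someHighest m (strip w) ≡ true → lastHighest (suc m) w ≡ lastHighest m (strip w)
lastHighest-strip m [] ()
lastHighest-strip m (row zero b l ∷ w) eq rewrite someHighest-strip m w | eq = lastHighest-strip m w eq
lastHighest-strip m (row (suc d) b l ∷ w) eq rewrite someHighest-strip m w with someHighest m (strip w) in eq′
... | true  = lastHighest-strip m w eq′
... | false = refl

somePeak : List Row → Bool
somePeak w = or (map peak w)

someHighest⇒somePeak : ∀ m w → someHighest m w ≡ true → somePeak w ≡ true
someHighest⇒somePeak m (row d b true ∷ w) eq = refl
someHighest⇒somePeak m (row d b false ∷ w) eq = someHighest⇒somePeak m w eq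

maxPeakDepth-nopeak : ∀ w → somePeak w ≡ false → maxPeakDepth w ≡ 0
maxPeakDepth-nopeak [] eq = refl
maxPeakDepth-nopeak (row d b false ∷ w) eq = maxPeakDepth-nopeak w eq

-- The maximum over no peaks is 0 by default, hence the test whether a peak survives below the
-- roots.
maxPeakDepth-strip : ∀ w → maxPeakDepth w ≡ (if somePeak (strip w) then suc (maxPeakDepth (strip w)) else 0)
maxPeakDepth-strip [] = refl
maxPeakDepth-strip (row zero b false ∷ w) = maxPeakDepth-strip w
maxPeakDepth-strip (row zero b true ∷ w) = maxPeakDepth-strip w
maxPeakDepth-strip (row (suc d) b false ∷ w) = maxPeakDepth-strip w
maxPeakDepth-strip (row (suc d) b true ∷ w) rewrite maxPeakDepth-strip w with somePeak (strip w) in eq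
... | true  = refl
... | false rewrite maxPeakDepth-nopeak (strip w) eq = cong suc (sym (⊔-identityʳ d))

lastFlag : Bool → Code → Bool
lastFlag b []             = b
lastFlag b ((c , _) ∷ cs) = lastFlag c cs

lastFlag-++ : ∀ b cs c d ds → lastFlag b (cs ++ (c , d) ∷ ds) ≡ lastFlag c ds
lastFlag-++ b [] c d ds = refl
lastFlag-++ b ((b′ , _) ∷ cs) c d ds = lastFlag-++ b′ cs c d ds

record LastHighest (w : List Row) (c : Bool) : Set where
  field
    exists : someHighest (maxPeakDepth w) w ≡ true
    last   : lastHighest (maxPeakDepth w) w ≡ c

-- On the deepest level all nodes are leaves, hence peaks of equal depth, and the rightmost of them
-- is the last in the code.
lastHighest-leaves : ∀ t f c → children (t ∷ f) ≡ [] → LastHighest (preRows 0 (t ∷ f) []) (lastFlag c (roots (t ∷ f)))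
lastHighest-leaves (node b []) [] c eq = record { exists = refl ; last = refl }
lastHighest-leaves (node b []) (t ∷ f) c eq = record { exists = trans (cong ((0 ≡ᵇ m) ∨_) exists) (∨-zeroʳ (0 ≡ᵇ m)) ; last = last′ }
  where
  open LastHighest (lastHighest-leaves t f b eq)
  m = maxPeakDepth (preRows 0 (t ∷ f) [])
  last′ : lastHighest (maxPeakDepth (preRows 0 (node b [] ∷ t ∷ f) [])) (preRows 0 (node b [] ∷ t ∷ f) []) ≡
          lastFlag b (roots (t ∷ f))
  last′ rewrite exists = last

-- As long as another level follows, `strip` keeps the highest peaks and their order, so the
-- rightmost one is found on the last level, as its last node.
lastHighest-levels : ∀ {t f cs} c → Levels (t ∷ f) cs → LastHighest (preRows 0 (t ∷ f) []) (lastFlag c cs)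
lastHighest-levels {t} {f} c (level eq [] refl) =
  subst (λ cs → LastHighest (preRows 0 (t ∷ f) []) (lastFlag c cs)) (sym (++-identityʳ (roots (t ∷ f))))
        (lastHighest-leaves t f c eq)
lastHighest-levels c (level {cs = []} _ (level {t = node _ _} _ _ ()) refl)
lastHighest-levels {t} {f} c (level {g = t′ ∷ f′} {cs = (b , k) ∷ cs} eq l refl) =
  record { exists = exists′ ; last = last′ }
  where
  w  = preRows 0 (t ∷ f) []
  w′ = preRows 0 (t′ ∷ f′) []
  stripped : strip w ≡ w′
  stripped = trans (strip-preRows (t ∷ f) []) (cong (λ g → preRows 0 g []) eq)
  open LastHighest (lastHighest-levels c l)
  max-suc : maxPeakDepth w ≡ suc (maxPeakDepth w′)
  max-suc rewrite maxPeakDepth-strip w | stripped | someHighest⇒somePeak (maxPeakDepth w′) w′ exists = refl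
  exists″ : someHighest (maxPeakDepth w′) (strip w) ≡ true
  exists″ = trans (cong (someHighest (maxPeakDepth w′)) stripped) exists
  exists′ : someHighest (maxPeakDepth w) w ≡ true
  exists′ = trans (cong (λ m → someHighest m w) max-suc) (trans (someHighest-strip _ w) exists″)
  last′ : lastHighest (maxPeakDepth w) w ≡ lastFlag c (roots (t ∷ f) ++ (b , k) ∷ cs)
  last′ = begin
    lastHighest (maxPeakDepth w) w               ≡⟨ cong (λ m → lastHighest m w) max-suc ⟩
    lastHighest (suc (maxPeakDepth w′)) w        ≡⟨ lastHighest-strip _ w exists″ ⟩
    lastHighest (maxPeakDepth w′) (strip w)      ≡⟨ cong (lastHighest (maxPeakDepth w′)) stripped ⟩
    lastHighest (maxPeakDepth w′) w′             ≡⟨ last ⟩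
    lastFlag b cs                                ≡⟨ lastFlag-++ c (roots (t ∷ f)) b k cs ⟨
    lastFlag c (roots (t ∷ f) ++ (b , k) ∷ cs)   ∎
    where open ≡-Reasoning

dfs-rightmostHighestPeak : ∀ {t f cs} → BFS (t ∷ f) cs →
  atB (peaks (dfs (t ∷ f) [])) (rightmostHighestPeak (steps (dfs (t ∷ f) []))) ≡ lastFlag false cs
dfs-rightmostHighestPeak {t} {f} c =
  trans (rightmostHighestPeak≡ (dfs (t ∷ f) []) _ (dfs-dyck 0 (t ∷ f) [] tt) (dfs-rows (t ∷ f)))
        (LastHighest.last (lastHighest-levels false (levels c)))

-- Words with flagged east steps

-- A decorated Dyck path as a word in which the flag of an east step says
-- whether the peak that it ends is decorated, if it follows a north step,
-- and whether the rise at the matching north step is, if it follows an east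
-- step (the matching parenthesis of such a step is a rise).
data EastFlagged : Set where
  ⇑  : EastFlagged
  ⇓_ : Bool → EastFlagged

stepsE : List EastFlagged → List Step
stepsE []        = []
stepsE (⇑ ∷ t)   = N ∷ stepsE t
stepsE (⇓ _ ∷ t) = E ∷ stepsE t

peaksE : List EastFlagged → List Bool
peaksE []            = []
peaksE (⇓ _ ∷ t)     = peaksE t
peaksE (⇑ ∷ [])      = false ∷ []
peaksE (⇑ ∷ ⇑ ∷ t)   = false ∷ peaksE (⇑ ∷ t)
peaksE (⇑ ∷ ⇓ b ∷ t) = b ∷ peaksE t

-- The flags on the stack are those of the north steps still to be matched.
data Match : List Bool → List NorthFlagged → List EastFlagged → Set where
  []  : Match [] [] []
  push : ∀ b {st s t} → Match (b ∷ st) s t → Match st (↑ b ∷ s) (⇑ ∷ t)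
  pop  : ∀ b {st s t} → Match st s t → Match (b ∷ st) (↓ ∷ s) (⇓ b ∷ t)

match-east : ∀ st s → DyckFrom (length st) (steps s) → ∃ (Match st s)
match-east [] [] d = [] , []
match-east st (↑ b ∷ s) d with match-east (b ∷ st) s d
... | t , m = ⇑ ∷ t , push b m
match-east (b ∷ st) (↓ ∷ s) d with match-east st s d
... | t , m = ⇓ b ∷ t , pop b m

-- The stack is returned from the end of the word: an east step puts its flag on it, and the
-- matching north step takes it off.
match-north : ∀ h t → DyckFrom h (stepsE t) → ∃ λ st → ∃ λ s → Match st s t × length st ≡ h
match-north zero [] d = [] , [] , [] , refl
match-north h (⇑ ∷ t) d with match-north (suc h) t d
... | b ∷ st , s , m , eq = st , ↑ b ∷ s , push b m , suc-injective eq
match-north (suc h) (⇓ b ∷ t) d with match-north h t d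
... | st , s , m , eq = b ∷ st , ↓ ∷ s , pop b m , cong suc eq

match-functional : ∀ {st s t t′} → Match st s t → Match st s t′ → t ≡ t′
match-functional [] [] = refl
match-functional (push b m) (push .b m′) = cong (⇑ ∷_) (match-functional m m′)
match-functional (pop b m) (pop .b m′) = cong (⇓ b ∷_) (match-functional m m′)

match-injective : ∀ {st st′ s s′ t} → Match st s t → Match st′ s′ t → st ≡ st′ × s ≡ s′
match-injective [] [] = refl , refl
match-injective (push b m) (push b′ m′) with match-injective m m′
... | refl , refl = refl , refl
match-injective (pop b m) (pop .b m′) with match-injective m m′
... | refl , refl = refl , refl

match-steps : ∀ {st s t} → Match st s t → steps s ≡ stepsE t
match-steps []      = refl
match-steps (push b m) = cong (N ∷_) (match-steps m)
match-steps (pop b m) = cong (E ∷_) (match-steps m)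

match-dyck : ∀ {st s t} → Match st s t → DyckFrom (length st) (steps s)
match-dyck []      = tt
match-dyck (push b m) = match-dyck m
match-dyck (pop b m) = match-dyck m

-- A north step followed at once by an east step is matched with it, so both carry the flag of the
-- peak.
match-peaks : ∀ {st s t} → Match st s t → peaks s ≡ peaksE t
match-peaks []            = refl
match-peaks (push b (push c m)) = cong (false ∷_) (match-peaks (push c m))
match-peaks (push b (pop .b m)) = cong (b ∷_) (match-peaks m)
match-peaks (pop b m)       = match-peaks m

colAreas : ℕ → List EastFlagged → ℕ
colAreas h []        = 0
colAreas h (⇑ ∷ t)   = colAreas (suc h) t
colAreas h (⇓ _ ∷ t) = pred h + colAreas (pred h) t

triangle : ℕ → ℕ
triangle zero    = 0
triangle (suc h) = h + triangle h

-- Matched steps run between the same two heights, so rows and columns give the same total. The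
-- unmatched north steps on the stack started at the heights below `length st`, which add up to
-- `triangle`.
match-area : ∀ {st s t} → Match st s t → colAreas (length st) t ≡ sum (rowAreas (length st) (steps s)) + triangle (length st)
match-area [] = refl
match-area {st} {↑ b ∷ s} {⇑ ∷ t} (push b m) rewrite match-area m =
  solve-assoc (length st) (sum (rowAreas (suc (length st)) (steps s))) (triangle (length st))
  where
  solve-assoc : ∀ h x y → x + (h + y) ≡ h + x + y
  solve-assoc = solve-∀
match-area {b ∷ st} {↓ ∷ s} (pop b m) rewrite match-area m =
  solve-assoc (length st) (sum (rowAreas (length st) (steps s))) (triangle (length st))
  where
  solve-assoc : ∀ h x y → h + (x + y) ≡ x + (h + y)
  solve-assoc = solve-∀

-- The counterpart of riseSum; e says whether the preceding step is east.
fallSum : (ℕ → ℕ) → Bool → ℕ → List EastFlagged → ℕ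
fallSum g e h []        = 0
fallSum g e h (⇑ ∷ t)   = fallSum g false (suc h) t
fallSum g e h (⇓ b ∷ t) = (if e ∧ b then g h else 0) + fallSum g true (pred h) t

stackSum : (ℕ → ℕ) → List Bool → ℕ
stackSum g []       = 0
stackSum g (b ∷ st) = (if b then g (suc (length st)) else 0) + stackSum g st

-- All the pending north steps are rises, except possibly the last one when
-- it is the preceding step.
mutual
  match-fallSum-north : ∀ g {b st s t} → Match (b ∷ st) s t →
    fallSum g false (suc (length st)) t ≡ riseSum g b (suc (length st)) s + stackSum g st
  match-fallSum-north g {b} {st} {↑ c ∷ s} (push c m) = trans (match-fallSum-north g m)
    (solve-assoc (riseSum g c (2 + length st) s) (if b then g (suc (length st)) else 0) (stackSum g st))
    where
    solve-assoc : ∀ x y z → x + (y + z) ≡ y + x + z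
    solve-assoc = solve-∀
  match-fallSum-north g (pop b m) = match-fallSum-east g m

  match-fallSum-east : ∀ g {st s t} → Match st s t →
    fallSum g true (length st) t ≡ riseSum g false (length st) s + stackSum g st
  match-fallSum-east g [] = refl
  match-fallSum-east g (push b m) = match-fallSum-north g m
  match-fallSum-east g {b ∷ st} {↓ ∷ s} (pop b m) = trans (cong (x +_) (match-fallSum-east g m))
    (solve-assoc x (riseSum g false (length st) s) (stackSum g st))
    where
    x = if b then g (suc (length st)) else 0
    solve-assoc : ∀ x y z → x + (y + z) ≡ y + (x + z)
    solve-assoc = solve-∀

match-fallSum : ∀ g {s t} → Match [] s t → fallSum g false 0 t ≡ riseSum g false 0 s
match-fallSum g []      = refl
match-fallSum g (push b m) = trans (match-fallSum-north g m) (+-identityʳ _)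

-- The flag b of a node is moved to the east step of the next node in
-- breadth-first order; the flag of the last node is lost.
word : ℕ → Bool → Code → List EastFlagged
word zero    b []              = []
word zero    b ((c , k) ∷ cs)  = ⇓ b ∷ word k c cs
word (suc k) b cs              = ⇑ ∷ word k b cs

word-surjective : ∀ t → ∃ λ k → ∃ λ b → ∃ λ cs → t ≡ word k b cs × lastFlag b cs ≡ false
-- The word does not record the flag of the last node; `false` is the choice that meets the
-- condition on `lastFlag`.
word-surjective [] = 0 , false , [] , refl , refl
word-surjective (⇑ ∷ t) with word-surjective t
... | k , b , cs , refl , eq = suc k , b , cs , refl , eq
word-surjective (⇓ b ∷ t) with word-surjective t
... | k , c , cs , refl , eq = 0 , b , (c , k) ∷ cs , refl , eq

word-injective : ∀ t k b cs k′ b′ cs′ → t ≡ word k b cs → t ≡ word k′ b′ cs′ →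
                 lastFlag b cs ≡ false → lastFlag b′ cs′ ≡ false → k ≡ k′ × b ≡ b′ × cs ≡ cs′
word-injective [] zero b [] zero b′ [] eq eq′ refl refl = refl , refl , refl
word-injective (⇑ ∷ t) (suc k) b cs (suc k′) b′ cs′ eq eq′ l l′
  with word-injective t k b cs k′ b′ cs′ (proj₂ (∷-injective eq)) (proj₂ (∷-injective eq′)) l l′
... | refl , refl , refl = refl , refl , refl
word-injective (⇓ x ∷ t) zero b ((c , k) ∷ cs) zero b′ ((c′ , k′) ∷ cs′) eq eq′ l l′
  with word-injective t k c cs k′ c′ cs′ (proj₂ (∷-injective eq)) (proj₂ (∷-injective eq′)) l l′
     | trans (sym (proj₁ (∷-injective eq))) (proj₁ (∷-injective eq′))
... | refl , refl , refl | refl = refl , refl , refl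
word-injective (⇑ ∷ t) zero b [] k′ b′ cs′ () eq′ l l′
word-injective (⇑ ∷ t) zero b (_ ∷ _) k′ b′ cs′ () eq′ l l′
word-injective (⇑ ∷ t) (suc k) b cs zero b′ [] eq () l l′
word-injective (⇑ ∷ t) (suc k) b cs zero b′ (_ ∷ _) eq () l l′

-- Reading the code backwards, each node takes its children from the end of
-- the queue.
unqueue : ∀ h k b cs → DyckFrom h (stepsE (word k b cs)) → ∃ λ f → BFS f cs × length f ≡ h + k
unqueue zero zero b [] d = [] , [] , refl
unqueue (suc h) zero b ((c , k) ∷ cs) d with unqueue h k c cs d
... | f , bf , eq with splitLength h k f eq
  where
  splitLength : ∀ h k (f : Forest) → length f ≡ h + k →
                ∃ λ g → ∃ λ ts → f ≡ g ++ ts × length g ≡ h × length ts ≡ k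
  splitLength zero    k f       eq = [] , f , refl , refl , eq
  splitLength (suc h) k (t ∷ f) eq with splitLength h k f (suc-injective eq)
  ... | g , ts , refl , eq₁ , eq₂ = t ∷ g , ts , refl , cong suc eq₁ , eq₂
... | g , ts , refl , refl , refl = node c ts ∷ g , node c ts bf , cong suc (sym (+-identityʳ (length g)))
unqueue h (suc k) b cs d with unqueue (suc h) k b cs d
... | f , bf , eq = f , bf , trans eq (sym (+-suc h k))

-- The height of the path is the length of the queue, less the `k` nodes whose north steps are still
-- to come. An east step takes a node off a nonempty queue, so the path stays above the diagonal.
BFS⇒dyck : ∀ {f cs} → BFS f cs → ∀ h k b → length f ≡ h + k → DyckFrom h (stepsE (word k b cs))
BFS⇒dyck bf h (suc k) b eq = BFS⇒dyck bf (suc h) k b (trans eq (+-suc h k))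
BFS⇒dyck [] zero zero b eq = tt
BFS⇒dyck (node {f} c ts bf) (suc h) zero b eq =
  BFS⇒dyck bf h (length ts) c
    (trans (length-++ f) (cong (_+ length ts) (trans (suc-injective eq) (+-identityʳ h))))

norths-word : ∀ k b m cs → norths (stepsE (word k b cs)) ≡ k + sumC (λ _ _ k → k) m cs
norths-word zero b m [] = refl
norths-word zero b m ((c , k) ∷ cs) = norths-word k c (pred m + k) cs
norths-word (suc k) b m cs = cong suc (norths-word k b m cs)

colAreas-word : ∀ h k b cs → colAreas h (word k b cs) ≡ sumC (λ q _ _ → q) (h + k) cs
colAreas-word h zero b [] = refl
colAreas-word h zero b ((c , k) ∷ cs) rewrite +-identityʳ h = cong (pred h +_) (colAreas-word (pred h) k c cs)
colAreas-word h (suc k) b cs =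
  trans (colAreas-word (suc h) k b cs) (cong (λ m → sumC (λ q _ _ → q) m cs) (sym (+-suc h k)))

-- The flag of a node sits on the east step after the north steps of its children, which directly
-- follows another east step exactly if the node is a leaf. The last node sits on no step but has a
-- term in `sumC`, which vanishes by the hypothesis.
fallSum-word : ∀ g e h k b cs → lastFlag b cs ≡ false →
  fallSum g e h (word k b cs) ≡
  (if e ∧ leafFlag b k then g h else 0) + sumC (λ q b k → if leafFlag b k then g q else 0) (h + k) cs
fallSum-word g true  h zero b [] refl = refl
fallSum-word g false h zero b [] refl = refl
fallSum-word g e h zero b ((c , k) ∷ cs) l rewrite +-identityʳ h =
  cong ((if e ∧ b then g h else 0) +_) (fallSum-word g true (pred h) k c cs l)
fallSum-word g e h (suc k) b cs l = trans (fallSum-word g false (suc h) k b cs l)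
  (cong₂ _+_ (sym (inner e)) (cong (λ m → sumC (λ q b k → if leafFlag b k then g q else 0) m cs) (sym (+-suc h k))))
  where
  inner : ∀ e → (if e ∧ false then g h else 0) ≡ 0
  inner true  = refl
  inner false = refl

-- The decorations of a run of k north steps followed by an east step.
run : Bool → ℕ → List Bool
run b zero          = []
run b (suc zero)    = b ∷ []
run b (suc (suc k)) = false ∷ run b (suc k)

runs : Code → List Bool
runs []             = []
runs ((b , k) ∷ cs) = run b k ++ runs cs

peaksE-word : ∀ h k b cs → DyckFrom h (stepsE (word k b cs)) → peaksE (word k b cs) ≡ run b k ++ runs cs
peaksE-word h zero b [] d = refl
peaksE-word (suc h) zero b ((c , k) ∷ cs) d = peaksE-word h k c cs d
peaksE-word h (suc zero) b ((c , k) ∷ cs) d = cong (b ∷_) (peaksE-word h k c cs d)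
peaksE-word h (suc (suc k)) b cs d = cong (false ∷_) (peaksE-word (suc h) (suc k) b cs d)

countTrue-++ : ∀ xs ys → countTrue (xs ++ ys) ≡ countTrue xs + countTrue ys
countTrue-++ [] ys = refl
countTrue-++ (true ∷ xs) ys = cong suc (countTrue-++ xs ys)
countTrue-++ (false ∷ xs) ys = countTrue-++ xs ys

countTrue-run : ∀ b k → countTrue (run b k) ≡ indicator (innerFlag b k)
countTrue-run b zero = refl
countTrue-run true (suc zero) = refl
countTrue-run false (suc zero) = refl
countTrue-run b (suc (suc k)) = countTrue-run b (suc k)

countTrue-runs : ∀ m cs → countTrue (runs cs) ≡ sumC (λ _ b k → indicator (innerFlag b k)) m cs
countTrue-runs m [] = refl
countTrue-runs m ((b , k) ∷ cs) =
  trans (countTrue-++ (run b k) (runs cs)) (cong₂ _+_ (countTrue-run b k) (countTrue-runs (pred m + k) cs))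

-- Statistics of the breadth-first code

firstPeakAux-suc : ∀ r bs → firstPeakAux (suc r) bs ≡ suc (firstPeakAux r bs)
firstPeakAux-suc r []           = refl
firstPeakAux-suc r (true ∷ bs)  = refl
firstPeakAux-suc r (false ∷ bs) = firstPeakAux-suc (suc r) bs

-- The north steps of the roots end in the first east step, whose flag is the initial `b` and
-- belongs to no node.
word-firstPeak : ∀ m b x cs → atB (peaksE (word (suc m) b (x ∷ cs))) (firstPeak (stepsE (word (suc m) b (x ∷ cs)))) ≡ b
word-firstPeak zero    b x cs = refl
word-firstPeak (suc m) b x cs
  rewrite firstPeakAux-suc 0 (peakFlags (stepsE (word (suc m) b (x ∷ cs)))) = word-firstPeak m b x cs

-- The bounce path of the breadth-first code

eastHeights : ℕ → Code → List ℕ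
eastHeights K []             = []
eastHeights K ((_ , k) ∷ cs) = K ∷ eastHeights (K + k) cs

northBeforeE-word : ∀ K k b cs → northBeforeEAux K (stepsE (word k b cs)) ≡ eastHeights (K + k) cs
northBeforeE-word K zero b [] = refl
northBeforeE-word K zero b ((c , k) ∷ cs) rewrite +-identityʳ K = cong (K ∷_) (northBeforeE-word K k c cs)
northBeforeE-word K (suc k) b cs =
  trans (northBeforeE-word (suc K) k b cs) (cong (λ K → eastHeights K cs) (sym (+-suc K k)))

eastHeights-roots : ∀ K f cs → eastHeights K (roots f ++ cs) ≡
                    eastHeights K (roots f) ++ eastHeights (K + length (children f)) cs
eastHeights-roots K [] cs = cong (λ K → eastHeights K cs) (sym (+-identityʳ K))
eastHeights-roots K (node b ts ∷ f) cs = cong (K ∷_)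
  (trans (eastHeights-roots (K + length ts) f cs)
    (cong (λ L → eastHeights (K + length ts) (roots f) ++ eastHeights L cs)
      (trans (+-assoc K (length ts) _) (cong (K +_) (sym (length-++ ts))))))

length-eastHeights : ∀ K f → length (eastHeights K (roots f)) ≡ length f
length-eastHeights K [] = refl
length-eastHeights K (node b ts ∷ f) = cong suc (length-eastHeights (K + length ts) f)

undecoratedSum : List ℕ → List Bool → ℕ
undecoratedSum []       dp       = 0
undecoratedSum (l ∷ ls) []       = 0
undecoratedSum (l ∷ ls) (b ∷ dp) = (if b then 0 else l) + undecoratedSum ls dp

undecoratedSum≡ : ∀ ls dp → sum (map (λ r → if atB dp r then 0 else atℕ ls r) (upTo (length dp))) ≡ undecoratedSum ls dp
undecoratedSum≡ ls dp = trans (cong sum (map-upTo _ (length dp))) (go ls dp)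
  where
  all-zero : ∀ dp → Σ< (length dp) (λ r → if atB dp r then 0 else 0) ≡ 0
  all-zero []           = refl
  all-zero (true ∷ dp)  = all-zero dp
  all-zero (false ∷ dp) = all-zero dp
  go : ∀ ls dp → Σ< (length dp) (λ r → if atB dp r then 0 else atℕ ls r) ≡ undecoratedSum ls dp
  go [] dp = all-zero dp
  go (l ∷ ls) [] = refl
  go (l ∷ ls) (b ∷ dp) = cong ((if b then 0 else l) +_) (go ls dp)

countFalse : List Bool → ℕ
countFalse []       = 0
countFalse (b ∷ bs) = (if b then 0 else 1) + countFalse bs

countFalse-++ : ∀ xs ys → countFalse (xs ++ ys) ≡ countFalse xs + countFalse ys
countFalse-++ [] ys = refl
countFalse-++ (x ∷ xs) ys = trans (cong (_ +_) (countFalse-++ xs ys)) (sym (+-assoc (if x then 0 else 1) (countFalse xs) _))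

undecoratedSum-replicate : ∀ d ls xs ys → undecoratedSum (replicate (length xs) d ++ ls) (xs ++ ys) ≡
                           d * countFalse xs + undecoratedSum ls ys
undecoratedSum-replicate d ls [] ys rewrite *-zeroʳ d = refl
undecoratedSum-replicate d ls (true ∷ xs) ys = undecoratedSum-replicate d ls xs ys
undecoratedSum-replicate d ls (false ∷ xs) ys rewrite undecoratedSum-replicate d ls xs ys =
  solve-assoc d (countFalse xs) (undecoratedSum ls ys)
  where
  solve-assoc : ∀ d c u → d + (d * c + u) ≡ d * suc c + u
  solve-assoc = solve-∀

length-run : ∀ b k → length (run b k) ≡ k
length-run b zero          = refl
length-run b (suc zero)    = refl
length-run b (suc (suc k)) = cong suc (length-run b (suc k))

countFalse-run : ∀ b k → countFalse (run b k) ≡ undecorated b k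
countFalse-run b zero = refl
countFalse-run b (suc zero) = refl
countFalse-run b (suc (suc k)) rewrite countFalse-run b (suc k) = sym (+-suc (if b then 0 else 1) k)

length-runs : ∀ f → length (runs (roots f)) ≡ length (children f)
length-runs [] = refl
length-runs (node b ts ∷ f) = begin
  length (run b (length ts) ++ runs (roots f))       ≡⟨ length-++ (run b (length ts)) ⟩
  length (run b (length ts)) + length (runs (roots f)) ≡⟨ cong₂ _+_ (length-run b (length ts)) (length-runs f) ⟩
  length ts + length (children f)                    ≡⟨ length-++ ts ⟨
  length (ts ++ children f)                          ∎
  where open ≡-Reasoning

countFalse-runs : ∀ d f → d * countFalse (runs (roots f)) ≡ sumRoots (λ b k → d * undecorated b k) f
countFalse-runs d [] = *-zeroʳ d
countFalse-runs d (node b ts ∷ f)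
  rewrite countFalse-++ (run b (length ts)) (runs (roots f)) | countFalse-run b (length ts) =
  trans (*-distribˡ-+ d (undecorated b (length ts)) _) (cong (d * undecorated b (length ts) +_) (countFalse-runs d f))

runs-++ : ∀ cs ds → runs (cs ++ ds) ≡ runs cs ++ runs ds
runs-++ [] ds = refl
runs-++ ((b , k) ∷ cs) ds = trans (cong (run b k ++_) (runs-++ cs ds)) (sym (++-assoc (run b k) (runs cs) (runs ds)))

atℕ-++ : ∀ xs y ys → atℕ (xs ++ y ∷ ys) (length xs) ≡ y
atℕ-++ []       y ys = refl
atℕ-++ (_ ∷ xs) y ys = atℕ-++ xs y ys

<ᵇ-true : ∀ {m n} → m < n → (m <ᵇ n) ≡ true
<ᵇ-true m<n = Equivalence.to T-≡ (<⇒<ᵇ m<n)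

<ᵇ-irrefl : ∀ m → (m <ᵇ m) ≡ false
<ᵇ-irrefl zero    = refl
<ᵇ-irrefl (suc m) = <ᵇ-irrefl m

-- The invariant at the bounce point reached after |pre| rows: f is the level
-- of depth d, whose rows are the next ones and have the decorations xs.
bounce-levels : ∀ {f cs} → Levels f cs → ∀ d fuel pre xs → length xs ≡ length f → length cs ≤ fuel →
  undecoratedSum (bounceLabelsAux fuel (pre ++ eastHeights (length pre + length f) cs) (length pre + length cs) d (length pre))
                 (xs ++ runs cs) ≡
  d * countFalse xs + sumF (λ d b k → suc d * undecorated b k) d f
bounce-levels [] d zero pre [] eq le rewrite *-zeroʳ d = refl
bounce-levels [] d (suc fuel) pre [] eq le
  rewrite *-zeroʳ d | +-identityʳ (length pre) | <ᵇ-irrefl (length pre) = refl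
bounce-levels (level {node c ts} {f} refl l refl) d zero pre xs eq ()
bounce-levels (level {t@(node c ts)} {f} {cs = cs} refl l refl) d (suc fuel) pre xs eq le = begin
  undecoratedSum (bounceLabelsAux (suc fuel) nb n d B) (xs ++ runs (roots F ++ cs))
    ≡⟨ cong (λ x → undecoratedSum (if x then labels else []) (xs ++ runs (roots F ++ cs)))
            (<ᵇ-true (m<m+n B {length (roots F ++ cs)} (s≤s z≤n))) ⟩
  undecoratedSum labels (xs ++ runs (roots F ++ cs))
    -- Column `B` belongs to the first node of the level. When that node is served, the whole level
    -- has joined the queue and nothing of the next, so the bounce path rises by exactly `length F`.
    ≡⟨ cong (λ b → undecoratedSum (replicate (b ∸ B) d ++ bounceLabelsAux fuel nb n (suc d) b) (xs ++ runs (roots F ++ cs)))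
            (atℕ-++ pre (B + length F) _) ⟩
  undecoratedSum (replicate (B + length F ∸ B) d ++ labels′) (xs ++ runs (roots F ++ cs))
    ≡⟨ cong₂ (λ m v → undecoratedSum (replicate m d ++ labels′) (xs ++ v))
             (trans (m+n∸m≡n B (length F)) (sym eq)) (runs-++ (roots F) cs) ⟩
  undecoratedSum (replicate (length xs) d ++ labels′) (xs ++ (runs (roots F) ++ runs cs))
    ≡⟨ undecoratedSum-replicate d labels′ xs _ ⟩
  d * countFalse xs + undecoratedSum labels′ (runs (roots F) ++ runs cs)
    ≡⟨ cong (λ v → d * countFalse xs + undecoratedSum v (runs (roots F) ++ runs cs)) labels′≡ ⟩
  d * countFalse xs + undecoratedSum (bounceLabelsAux fuel (pre′ ++ eastHeights (length pre′ + length (children F)) cs)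
                                                      (length pre′ + length cs) (suc d) (length pre′))
                                     (runs (roots F) ++ runs cs)
    ≡⟨ cong (d * countFalse xs +_)
            (bounce-levels l (suc d) fuel pre′ (runs (roots F)) (length-runs F) shorter) ⟩
  d * countFalse xs + (suc d * countFalse (runs (roots F)) + sumF φ (suc d) (children F))
    ≡⟨ cong (λ x → d * countFalse xs + (x + sumF φ (suc d) (children F))) (countFalse-runs (suc d) F) ⟩
  d * countFalse xs + (sumRoots (φ d) F + sumF φ (suc d) (children F))
    ≡⟨ cong (d * countFalse xs +_) (sumF-level φ d F) ⟨
  d * countFalse xs + sumF φ d F ∎
  where
  open ≡-Reasoning
  F = t ∷ f
  B = length pre
  n = B + length (roots F ++ cs)
  φ : ℕ → Bool → ℕ → ℕ
  φ = λ d b k → suc d * undecorated b k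
  nb   = pre ++ eastHeights (B + length F) (roots F ++ cs)
  pre′ = pre ++ eastHeights (B + length F) (roots F)
  labels  = replicate (atℕ nb B ∸ B) d ++ bounceLabelsAux fuel nb n (suc d) (atℕ nb B)
  labels′ = bounceLabelsAux fuel nb n (suc d) (B + length F)
  length-pre′ : length pre′ ≡ B + length F
  length-pre′ = trans (length-++ pre) (cong (B +_) (length-eastHeights (B + length F) F))
  n≡ : n ≡ length pre′ + length cs
  n≡ = begin
    B + length (roots F ++ cs)             ≡⟨ cong (B +_) (length-++ (roots F)) ⟩
    B + (length (roots F) + length cs)     ≡⟨ +-assoc B _ _ ⟨
    B + length (roots F) + length cs       ≡⟨ cong (λ m → B + m + length cs) (length-roots F) ⟩
    B + length F + length cs               ≡⟨ cong (_+ length cs) length-pre′ ⟨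
    length pre′ + length cs                ∎
  nb≡ : nb ≡ pre′ ++ eastHeights (length pre′ + length (children F)) cs
  nb≡ = begin
    pre ++ eastHeights (B + length F) (roots F ++ cs)
      ≡⟨ cong (pre ++_) (eastHeights-roots (B + length F) F cs) ⟩
    pre ++ (eastHeights (B + length F) (roots F) ++ eastHeights (B + length F + length (children F)) cs)
      ≡⟨ ++-assoc pre _ _ ⟨
    pre′ ++ eastHeights (B + length F + length (children F)) cs
      ≡⟨ cong (λ m → pre′ ++ eastHeights (m + length (children F)) cs) length-pre′ ⟨
    pre′ ++ eastHeights (length pre′ + length (children F)) cs ∎
  labels′≡ : labels′ ≡ bounceLabelsAux fuel (pre′ ++ eastHeights (length pre′ + length (children F)) cs)
                                       (length pre′ + length cs) (suc d) (length pre′)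
  labels′≡ = trans (cong (bounceLabelsAux fuel nb n (suc d)) (sym length-pre′))
                   (cong₂ (λ v m → bounceLabelsAux fuel v m (suc d) (length pre′)) nb≡ n≡)
  shorter : length cs ≤ fuel
  shorter = ≤-trans (m≤n+m (length cs) (length (roots f)))
                    (≤-trans (≤-reflexive (sym (length-++ (roots f)))) (≤-pred le))

length-BFS : ∀ {f cs} → BFS f cs → length cs ≡ size f
length-BFS {f} {cs} c = trans (go (length f) cs) (sym (BFS⇒sumF≡sumC (λ _ _ → 1) (length f) 0 c))
  where
  go : ∀ m cs → length cs ≡ sumC (λ _ _ _ → 1) m cs
  go m [] = refl
  go m ((b , k) ∷ cs) = cong suc (go (pred m + k) cs)

module BreadthFirst {f : Forest} {cs : Code} {s : List NorthFlagged} (bf : BFS f cs)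
                    (m : Match [] s (word (length f) false cs)) (last : lastFlag false cs ≡ false) where

  open ≡-Reasoning

  private
    t = word (length f) false cs

  dyck : DyckFrom 0 (stepsE t)
  dyck = BFS⇒dyck bf 0 (length f) false refl

  size≡ : norths (steps s) ≡ size f
  size≡ = begin
    norths (steps s)                             ≡⟨ cong norths (match-steps m) ⟩
    norths (stepsE t)                            ≡⟨ norths-word (length f) false 0 cs ⟩
    length f + sumC (λ _ _ k → k) 0 cs           ≡⟨ cong (length f +_) (BFS⇒sumF≡sumC (λ _ k → k) 0 0 bf) ⟨
    length f + sumF (λ _ _ k → k) 0 f            ≡⟨ sumF-size 0 f ⟨
    size f                                       ∎

  peaks≡ : peaks s ≡ run false (length f) ++ runs cs
  peaks≡ = trans (match-peaks m) (peaksE-word 0 (length f) false cs dyck)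

  #peaks≡ : countTrue (peaks s) ≡ sumF (λ _ b k → indicator (innerFlag b k)) 0 f
  #peaks≡ = begin
    countTrue (peaks s)                                         ≡⟨ cong countTrue peaks≡ ⟩
    countTrue (run false (length f) ++ runs cs)                 ≡⟨ countTrue-++ (run false (length f)) _ ⟩
    countTrue (run false (length f)) + countTrue (runs cs)
      ≡⟨ cong (_+ countTrue (runs cs)) (trans (countTrue-run false (length f)) (none (length f))) ⟩
    countTrue (runs cs)                                         ≡⟨ countTrue-runs 0 cs ⟩
    sumC (λ _ b k → indicator (innerFlag b k)) 0 cs             ≡⟨ BFS⇒sumF≡sumC (λ b k → indicator (innerFlag b k)) 0 0 bf ⟨
    sumF (λ _ b k → indicator (innerFlag b k)) 0 f              ∎
    where
    none : ∀ k → indicator (innerFlag false k) ≡ 0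
    none zero    = refl
    none (suc k) = refl

  riseSum≡ : ∀ g → riseSum g false 0 s ≡ sumC (λ q b k → if leafFlag b k then g q else 0) (length f) cs
  riseSum≡ g = trans (sym (match-fallSum g m)) (fallSum-word g false 0 (length f) false cs last)

  #rises≡ : countTrue (rises s) ≡ sumF (λ _ b k → indicator (leafFlag b k)) 0 f
  #rises≡ = begin
    countTrue (rises s)                                      ≡⟨ countTrue-rises 0 s ⟩
    riseSum (const 1) false 0 s                              ≡⟨ riseSum≡ (const 1) ⟩
    sumC (λ _ b k → indicator (leafFlag b k)) (length f) cs  ≡⟨ BFS⇒sumF≡sumC (λ b k → indicator (leafFlag b k)) (length f) 0 bf ⟨
    sumF (λ _ b k → indicator (leafFlag b k)) 0 f            ∎

  -- Counted by columns, the area is the sum of the queue lengths after each removal. The rise that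
  -- a decorated leaf gives rise to has just that height and cancels its term, as `φ-dinv` does.
  area≡ : areaR (toRaw s) ≡ sumC φ-dinv (length f) cs
  area≡ = begin
    areaR (toRaw s)                                           ≡⟨ areaR-toRaw s (match-dyck m) ⟩
    sum (rowAreas 0 (steps s)) ∸ riseSum id false 0 s         ≡⟨ cong₂ _∸_ total (riseSum≡ id) ⟩
    sumC φ-dinv (length f) cs + R ∸ R                         ≡⟨ m+n∸n≡m (sumC φ-dinv (length f) cs) R ⟩
    sumC φ-dinv (length f) cs                                 ∎
    where
    ψ : ℕ → Bool → ℕ → ℕ
    ψ = λ q b k → if leafFlag b k then q else 0
    R = sumC ψ (length f) cs
    split : ∀ q b k → q ≡ φ-dinv q b k + ψ q b k
    split q b k with leafFlag b k
    ... | true  = refl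
    ... | false = sym (+-identityʳ q)
    total : sum (rowAreas 0 (steps s)) ≡ sumC φ-dinv (length f) cs + R
    total = begin
      sum (rowAreas 0 (steps s))              ≡⟨ +-identityʳ _ ⟨
      sum (rowAreas 0 (steps s)) + 0          ≡⟨ match-area m ⟨
      colAreas 0 t                            ≡⟨ colAreas-word 0 (length f) false cs ⟩
      sumC (λ q _ _ → q) (length f) cs        ≡⟨ sumC-cong split (length f) cs ⟩
      sumC (λ q b k → φ-dinv q b k + ψ q b k) (length f) cs ≡⟨ sumC-+ φ-dinv ψ (length f) cs ⟩
      sumC φ-dinv (length f) cs + R           ∎

  bounce≡ : bounceR (toRaw s) ≡ areaF f
  bounce≡ = begin
    bounceR (toRaw s)
      ≡⟨⟩
    value (length (areaWord (steps s))) (northBeforeE (steps s)) (peaks s)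
      ≡⟨ cong (λ k → value k (northBeforeE (steps s)) (peaks s)) size′ ⟩
    value (length cs) (northBeforeE (steps s)) (peaks s)
      ≡⟨ cong (λ v → value (length cs) v (peaks s))
              (trans (cong northBeforeE (match-steps m)) (northBeforeE-word 0 (length f) false cs)) ⟩
    value (length cs) nb (peaks s)
      ≡⟨ cong (λ k → sum (map (λ r → if atB (peaks s) r then 0 else atℕ labels r) (upTo k)))
              (trans (sym size″) (sym (length-peaks s))) ⟩
    sum (map (λ r → if atB (peaks s) r then 0 else atℕ labels r) (upTo (length (peaks s))))
      ≡⟨ undecoratedSum≡ labels (peaks s) ⟩
    undecoratedSum labels (peaks s)
      ≡⟨ cong (undecoratedSum labels) peaks≡ ⟩
    undecoratedSum labels (run false (length f) ++ runs cs)
      ≡⟨ bounce-levels (levels bf) 0 (length cs) [] (run false (length f)) (length-run false (length f)) ≤-refl ⟩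
    areaF f ∎
    where
    value : ℕ → List ℕ → List Bool → ℕ
    value k v dp = sum (map (λ r → if atB dp r then 0 else atℕ (bounceLabelsAux k v k 0 0) r) (upTo k))
    nb = eastHeights (length f) cs
    labels = bounceLabelsAux (length cs) nb (length cs) 0 0
    size″ : norths (steps s) ≡ length cs
    size″ = trans size≡ (sym (length-BFS bf))
    size′ : length (areaWord (steps s)) ≡ length cs
    size′ = trans (cong length (areaWord≡rowAreas (steps s) (match-dyck m)))
                  (trans (length-rowAreas 0 (steps s)) size″)

-- The bijection

-- The graph of the bijection: `D` and `P` come from the depth-first and the breadth-first code of
-- one forest. As a relation it can be read from either side, so injectivity and surjectivity need
-- no explicit inverse map.
record Zeta (D P : Raw) : Set where
  field
    {forest} : Forest
    {code}   : Code
    {image}  : List NorthFlagged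
    bf       : BFS forest code
    last     : lastFlag false code ≡ false
    matching : Match [] image (word (length forest) false code)
    D≡       : D ≡ toRaw (dfs forest [])
    P≡       : P ≡ toRaw image

zeta-functional : ∀ {D P P′} → Zeta D P → Zeta D P′ → P ≡ P′
zeta-functional {D} {P} {P′} z z′ = go bf Z′.bf matching Z′.matching forest≡
  where
  open Zeta z
  module Z′ = Zeta z′
  D≡D = trans (sym D≡) Z′.D≡
  forest≡ : forest ≡ Z′.forest
  forest≡ = dfs-injective forest Z′.forest
    (toRaw-injective 0 _ _ (dfs-dyck 0 forest [] tt) (cong path D≡D) (cong dPeak D≡D) (cong dRise D≡D))
  -- Generalised to variable forests, since an equation between fields of two records cannot be
  -- matched with `refl`.
  go : ∀ {f f′ cs cs′} → BFS f cs → BFS f′ cs′ → Match [] image (word (length f) false cs) →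
       Match [] Z′.image (word (length f′) false cs′) → f ≡ f′ → P ≡ P′
  go b b′ m m′ refl with BFS-functional b b′
  ... | refl = trans P≡ (trans (cong toRaw (proj₂ (match-injective m m′))) (sym Z′.P≡))

zeta-injective : ∀ {D D′ P} → Zeta D P → Zeta D′ P → D ≡ D′
zeta-injective {D} {D′} {P} z z′ = trans D≡ (trans (cong (λ f → toRaw (dfs f [])) forest≡) (sym Z′.D≡))
  where
  open Zeta z
  module Z′ = Zeta z′
  P≡P = trans (sym P≡) Z′.P≡
  image≡ : image ≡ Z′.image
  image≡ = toRaw-injective 0 _ _ (match-dyck matching) (cong path P≡P) (cong dPeak P≡P) (cong dRise P≡P)
  code≡ : code ≡ Z′.code
  code≡ = proj₂ (proj₂ (word-injective _ _ _ code _ _ Z′.code refl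
    (match-functional matching (subst (λ s → Match [] s _) (sym image≡) Z′.matching)) last Z′.last))
  forest≡ : forest ≡ Z′.forest
  forest≡ = BFS-injective bf Z′.bf code≡

dfs-WordOf : ∀ {n a b} f → size f ≡ n → sumF (λ _ b k → indicator (leafFlag b k)) 0 f ≡ a →
             sumF (λ _ b k → indicator (innerFlag b k)) 0 f ≡ b → WordOf n a b (dfs f [])
dfs-WordOf f eq eqᵃ eqᵇ =
  wordOf (dfs-dyck 0 f [] tt) (trans (dfs-size f) eq) (trans (dfs-#peaks f) eqᵃ) (trans (dfs-#rises f) eqᵇ)

not-decorated : ∀ {x} → x ≡ false → T (not x)
not-decorated = Equivalence.from T-not-≡

undecorated⇒false : ∀ {x} → T (not x) → x ≡ false
undecorated⇒false = Equivalence.to T-not-≡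

-- The undecorated rightmost highest peak says that the flag lost by `word` is `false`; the first
-- peak of the image is undecorated because the word starts with the flag `false`.
zeta-total : ∀ {n a b} → 1 ≤ n → (D : 𝒟̃ n a b) → ∃ λ (P : 𝒟̂ n b a) → Zeta (proj₁ (proj₁ D)) (proj₁ (proj₁ P))
zeta-total 1≤n ((D , valid) , nice) with valid⇒flagged D valid
... | s , refl , w@(wordOf dyckˢ _ _ _) with parse 0 s dyckˢ
zeta-total () ((D , valid) , nice) | s , refl , wordOf _ refl _ _ | [] , [] , refl
zeta-total {n} {a} {b} 1≤n ((D , valid) , nice) | s , refl , w | f@(_ ∷ f′) , [] , refl with bfs f
... | cs@((c , k) ∷ cs′) , bf , _ with match-north 0 _ (BFS⇒dyck bf 0 (length f) false refl)
... | [] , s′ , m , refl =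
  ((toRaw s′ , wordOf⇒valid w′) , not-decorated firstPeak≡) ,
  record { bf = bf ; last = last ; matching = m ; D≡ = refl ; P≡ = refl }
  where
  open WordOf w
  last : lastFlag false cs ≡ false
  last = trans (sym (dfs-rightmostHighestPeak bf)) (undecorated⇒false nice)
  open BreadthFirst bf m last
  w′ : WordOf n b a s′
  w′ = wordOf (match-dyck m)
    (trans size≡ (trans (sym (dfs-size f)) size′))
    (trans #peaks≡ (trans (sym (dfs-#rises f)) #rises))
    (trans #rises≡ (trans (sym (dfs-#peaks f)) #peaks))
    where size′ = WordOf.size w
  firstPeak≡ : atB (peaks s′) (firstPeak (steps s′)) ≡ false
  firstPeak≡ rewrite match-peaks m | match-steps m = word-firstPeak (length f′) false (c , k) cs′

zeta-onto : ∀ {n a b} → 1 ≤ n → (P : 𝒟̂ n b a) → ∃ λ (D : 𝒟̃ n a b) → Zeta (proj₁ (proj₁ D)) (proj₁ (proj₁ P))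
zeta-onto 1≤n ((P , valid) , nice) with valid⇒flagged P valid
... | s , refl , w@(wordOf dyckˢ _ _ _) with match-east [] s dyckˢ
... | t , m with word-surjective t
... | k , c , cs , refl , last with unqueue 0 k c cs (subst (DyckFrom 0) (match-steps m) dyckˢ)
zeta-onto () ((P , valid) , nice) | .[] , refl , wordOf _ refl _ _ | _ , [] | zero , c , [] , refl , last | [] , [] , refl
zeta-onto {n} {a} {b} 1≤n ((P , valid) , nice)
  | s , refl , w | _ , m | .(suc (length f)) , c , cs@(x ∷ cs′) , refl , last | t ∷ f , bf , refl
  -- The initial flag `c` is the decoration of the first peak, hence `false`, as `Zeta` requires.
  with trans (sym (word-firstPeak (length f) c x cs′))
         (trans (cong₂ (λ dp p → atB dp (firstPeak p)) (sym (match-peaks m)) (sym (match-steps m)))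
                (undecorated⇒false nice))
... | refl =
  ((toRaw (dfs (t ∷ f) []) , wordOf⇒valid w′) , not-decorated (trans (dfs-rightmostHighestPeak bf) last)) ,
  record { bf = bf ; last = last ; matching = m ; D≡ = refl ; P≡ = refl }
  where
  open BreadthFirst bf m last
  w′ : WordOf n a b (dfs (t ∷ f) [])
  w′ = dfs-WordOf (t ∷ f)
    (trans (sym size≡) (WordOf.size w))
    (trans (sym #rises≡) (WordOf.#rises w))
    (trans (sym #peaks≡) (WordOf.#peaks w))

zeta-area : ∀ {D P} → Zeta D P → areaR D ≡ bounceR P
zeta-area record { forest = f ; bf = bf ; last = last ; matching = m ; D≡ = refl ; P≡ = refl } =
  trans (dfs-area f) (sym (BreadthFirst.bounce≡ bf m last))

zeta-dinv : ∀ {D P} → Zeta D P → dinvR D ≡ areaR P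
zeta-dinv record { bf = bf ; last = last ; matching = m ; D≡ = refl ; P≡ = refl } =
  trans (dfs-dinv bf) (sym (BreadthFirst.area≡ bf m last))

-- All side conditions are of the form `T _` and so have at most one proof; decorated paths are
-- equal once the underlying raw data are.
Σ-T-≡ : ∀ {A : Set} (p q : A → Bool) {x y : A} {u : T (p x)} {u′ : T (p y)} {v : T (q x)} {v′ : T (q y)} → x ≡ y →
        _≡_ {A = Σ (Σ A (T ∘ p)) (T ∘ q ∘ proj₁)} ((x , u) , v) ((y , u′) , v′)
Σ-T-≡ p q {x} {u = u} {u′} {v} {v′} refl with T-irrelevant {p x} u u′ | T-irrelevant {q x} v v′
... | refl | refl = refl

theorem2p3 : (n a b : ℕ) → 1 ≤ n →
    Σ (𝒟̃ n a b ⤖ 𝒟̂ n b a) (λ ζ → (D : 𝒟̃ n a b) →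
    (area (proj₁ D) ≡ bounce (proj₁ (Bijection.to ζ D)))
    × (dinv (proj₁ D) ≡ area (proj₁ (Bijection.to ζ D))))
theorem2p3 n a b 1≤n =
  mk⤖ {to = to} (injective , surjective) , λ D → zeta-area (isZeta D) , zeta-dinv (isZeta D)
  where
  to : 𝒟̃ n a b → 𝒟̂ n b a
  to D = proj₁ (zeta-total 1≤n D)
  isZeta : ∀ D → Zeta (proj₁ (proj₁ D)) (proj₁ (proj₁ (to D)))
  isZeta D = proj₂ (zeta-total 1≤n D)
  ≡̃ : ∀ {D D′ : 𝒟̃ n a b} → proj₁ (proj₁ D) ≡ proj₁ (proj₁ D′) → D ≡ D′
  ≡̃ = Σ-T-≡ (validDecorated n a b) (λ D → not (atB (dPeak D) (rightmostHighestPeak (path D))))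
  ≡̂ : ∀ {P P′ : 𝒟̂ n b a} → proj₁ (proj₁ P) ≡ proj₁ (proj₁ P′) → P ≡ P′
  ≡̂ = Σ-T-≡ (validDecorated n b a) (λ P → not (atB (dPeak P) (firstPeak (path P))))
  injective : ∀ {D D′} → to D ≡ to D′ → D ≡ D′
  injective {D} {D′} eq = ≡̃ (zeta-injective
    (subst (λ P → Zeta (proj₁ (proj₁ D)) (proj₁ (proj₁ P))) eq (isZeta D)) (isZeta D′))
  surjective : ∀ P → ∃ λ D → ∀ {D′} → D′ ≡ D → to D′ ≡ P
  surjective P with zeta-onto 1≤n P
  ... | D , z = D , λ { refl → ≡̂ (zeta-functional (isZeta D) z) }
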